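{- Let $d\ge1$ and let $G_1=(V_1,E_1)$ and $G_2=(V_2,E_2)$ be two graphs with $G_1\cap G_2\cong K_2$ and $E_1\cap E_2=\{e\}$, such that $e$ is not a coloop in either $\mathcal{R}_d(G_1)$ or $\mathcal{R}_d(G_2)$. If $G$ is the graphical parallel connection of $G_1$ and $G_2$ along $e$, then $\mathcal{R}_d(G)=P(\mathcal{R}_d(G_1),\mathcal{R}_d(G_2))$. Moreover, if $G'$ is the graphical 2-sum of $G_1$ and $G_2$ along $e$, then $\mathcal{R}_d(G')=\mathcal{R}_d(G_1)\oplus_2\mathcal{R}_d(G_2)$.
   Context: For a graph $G=(V,E)$ and a generic $p:V\to\mathbb{R}^d$ (coordinates algebraically independent over $\mathbb{Q}$), the rigidity matrix $R(G,p)$ has a row for each $uv\in E$ with $p(u)-p(v)$ in the $d$ columns of $u$, $p(v)-p(u)$ in those of $v$, zeros elsewhere. $\mathcal{R}_d(G)$ is its row matroid on $E$. A coloop of a matroid is an element contained in no circuit. Graphical operations: for graphs $G_1,G_2$ with $G_1\cap G_2\cong K_2$ and $E_1\cap E_2=\{e\}$, the graphical parallel connection along $e$ is $G_1\cup G_2$ and the graphical 2-sum along $e$ is $(G_1\cup G_2)-e$. Matroid operations: for matroids $\mathcal{M}_1,\mathcal{M}_2$ on $E_1,E_2$ with $E_1\cap E_2=\{e\}$, $e$ neither a loop nor a coloop of either, the parallel connection $P(\mathcal{M}_1,\mathcal{M}_2)$ is the matroid on $E_1\cup E_2$ whose circuits are the circuits of $\mathcal{M}_1$, the circuits of $\mathcal{M}_2$,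 and the sets $(C_1\cup C_2)-e$ where $C_i$ is a circuit of $\mathcal{M}_i$ containing $e$ for $i=1,2$. The 2-sum $\mathcal{M}_1\oplus_2\mathcal{M}_2$ is the matroid on $(E_1\cup E_2)-e$ whose circuits are the circuits of $\mathcal{M}_1$ or $\mathcal{M}_2$ not containing $e$, together with the sets $(C_1\cup C_2)-e$ where $C_i$ is a circuit of $\mathcal{M}_i$ containing $e$ for $i=1,2$. -}

module Defs where

open import Level using (0ℓ)
open import Algebra.Bundles using (CommutativeRing)
import Algebra.Properties.Ring as RingProperties
import Algebra.Properties.Semiring.Sum as SemiringSum
open import Data.Bool.Base using (if_then_else_)
open import Data.Empty using (⊥-elim)
open import Data.Fin.Base as Fin using (Fin; zero; suc; combine; remQuot)
open import Data.Fin.Patterns using (0F; 1F)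
import Data.Fin.Properties as Fin
open import Data.Fin.Subset renaming (_-_ to infixl 5 _∖_)
open import Data.Fin.Subset.Properties
open import Data.List.Base using (List; []; _∷_)
open import Data.List.Relation.Unary.All using (All)
open import Data.Nat.Base as ℕ using (ℕ; zero; suc)
import Data.Nat.Properties as ℕ
open import Data.Product as Product using (∃; ∃₂; _×_; _,_; proj₁; proj₂)
open import Data.Rational.Base as ℚ using (ℚ; 0ℚ; 1ℚ; ½)
import Data.Rational.Properties as ℚ
open import Data.Rational.Solver using (module +-*-Solver)
open import Data.Sum.Base as Sum using (_⊎_; inj₁; inj₂; [_,_]′)
open import Data.Vec.Base using ([]; _∷_; here; there)
open import Data.Vec.Functional using (Vector; head; tail)
open import Function.Base using (_∘_; _$_)
open import Function.Bundles using (_⇔_; _↔_; Inverse)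
open import Function.Definitions using (Injective)
open import Relation.Binary.PropositionalEquality as ≡ using (_≡_; _≢_)
open import Relation.Nullary using (¬_; Dec; yes; no; does; contradiction)

------------------------------------------------------------------------
-- Linear independence over ℝ is not a decidable predicate, so the exchange
-- axiom of a matroid asserts the existence of x only up to double negation.

record Matroid (m : ℕ) : Set₁ where
  field
    ground        : Subset m
    Indep         : Subset m → Set
    indep⇒⊆ground : ∀ {I} → Indep I → I ⊆ ground
    indep-⊥       : Indep ⊥
    indep-⊆       : ∀ {I J} → I ⊆ J → Indep J → Indep I
    augment       : ∀ {I J} → Indep I → Indep J → ∣ I ∣ ℕ.< ∣ J ∣ →
                    ¬ ¬ (∃ λ x → x ∈ J × x ∉ I × Indep (I ∪ ⁅ x ⁆))


open Matroid public

module _ {m} (M : Matroid m) where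

  Circuit : Subset m → Set
  Circuit C = C ⊆ ground M × ¬ Indep M C × (∀ D → D ⊂ C → Indep M D)

  Loop : Fin m → Set
  Loop e = Circuit ⁅ e ⁆

  Coloop : Fin m → Set
  Coloop e = e ∈ ground M × (∀ C → Circuit C → e ∉ C)

module _ {m} (M₁ M₂ : Matroid m) (e : Fin m) where

  record Gluable : Set where
    field
      meet       : ground M₁ ∩ ground M₂ ≡ ⁅ e ⁆
      notLoop₁   : ¬ Loop M₁ e
      notLoop₂   : ¬ Loop M₂ e
      notColoop₁ : ¬ Coloop M₁ e
      notColoop₂ : ¬ Coloop M₂ e

  GluedCircuit : Subset m → Set
  GluedCircuit C = ∃₂ λ C₁ C₂ →
    (Circuit M₁ C₁ × e ∈ C₁) × (Circuit M₂ C₂ × e ∈ C₂) × C ≡ (C₁ ∪ C₂) ∖ e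

  -- M = P(M₁, M₂) and M = M₁ ⊕₂ M₂ respectively: these matroids are
  -- specified by their ground sets and circuits.
  record IsParallelConnection (M : Matroid m) : Set where
    field
      gluable  : Gluable
      ground-≡ : ground M ≡ ground M₁ ∪ ground M₂
      circuits : ∀ C → Circuit M C ⇔ (Circuit M₁ C ⊎ Circuit M₂ C ⊎ GluedCircuit C)

  record Is2Sum (M : Matroid m) : Set where
    field
      gluable  : Gluable
      ground-≡ : ground M ≡ (ground M₁ ∪ ground M₂) ∖ e
      circuits : ∀ C → Circuit M C ⇔
        ((Circuit M₁ C × e ∉ C) ⊎ (Circuit M₂ C × e ∉ C) ⊎ GluedCircuit C)

------------------------------------------------------------------------
-- The row matroid of a matrix over an integral domain.  The columns J form an
-- arbitrary type, and only the rows indexed by the ground set E matter.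

private
  ∣p∣≤1+∣p∖x∣ : ∀ {m} (p : Subset m) x → ∣ p ∣ ℕ.≤ suc ∣ p ∖ x ∣
  ∣p∣≤1+∣p∖x∣ (inside  ∷ p) zero    = ℕ.s≤s (ℕ.≤-reflexive (≡.cong ∣_∣ (≡.sym (p─⊥≡p p))))
  ∣p∣≤1+∣p∖x∣ (outside ∷ p) zero    = ℕ.m≤n⇒m≤1+n (ℕ.≤-reflexive (≡.cong ∣_∣ (≡.sym (p─⊥≡p p))))
  ∣p∣≤1+∣p∖x∣ (inside  ∷ p) (suc x) = ℕ.s≤s (∣p∣≤1+∣p∖x∣ p x)
  ∣p∣≤1+∣p∖x∣ (outside ∷ p) (suc x) = ∣p∣≤1+∣p∖x∣ p x

  x∉p∖x : ∀ {m} (p : Subset m) x → x ∉ p ∖ x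
  x∉p∖x (_ ∷ p) zero    ()
  x∉p∖x (_ ∷ p) (suc x) (there x∈) = x∉p∖x p x x∈

  ¬¬-∀ : ∀ {m} {Q : Fin m → Set} → (∀ x → ¬ ¬ Q x) → ¬ ¬ (∀ x → Q x)
  ¬¬-∀ {zero}  _ k = k λ ()
  ¬¬-∀ {suc m} h k = h zero λ q → ¬¬-∀ (h ∘ suc) λ qs → k λ where
    zero    → q
    (suc x) → qs x

record IsDomain (R : CommutativeRing 0ℓ 0ℓ) : Set where
  open CommutativeRing R hiding (zero)
  field
    1≉0       : ¬ (1# ≈ 0#)
    ≈0-stable : ∀ x → ¬ ¬ (x ≈ 0#) → x ≈ 0#
    cancel    : ∀ x y → ¬ (x ≈ 0#) → x * y ≈ 0# → y ≈ 0#

module RowMatroid (R : CommutativeRing 0ℓ 0ℓ) (domain : IsDomain R) where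

  open CommutativeRing R hiding (zero)
  open IsDomain domain
  open SemiringSum semiring using (sum-syntax; sum-cong-≋; sum-replicate-zero; ∑-distrib-+; ∑-comm; *-distribˡ-sum; *-distribʳ-sum)
  open import Relation.Binary.Reasoning.Setoid setoid
  open RingProperties ring using (-‿distribʳ-*)

  SupportedOn : ∀ {m} → Subset m → (Fin m → Carrier) → Set
  SupportedOn S c = ∀ e → e ∉ S → c e ≈ 0#

  RowsIndependent : ∀ {m} {J : Set} → (Fin m → J → Carrier) → Subset m → Set
  RowsIndependent {m} A S =
    ∀ c → SupportedOn S c → (∀ j → ∑[ e < m ] (c e * A e j) ≈ 0#) → ∀ e → c e ≈ 0#

  private
    0*+ : ∀ x y z → x ≈ 0# → y ≈ 0# → x + y * z ≈ 0#
    0*+ x y z x0 y0 = trans (+-cong x0 (trans (*-congʳ y0) (zeroˡ z))) (+-identityˡ 0#)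

    *0 : ∀ x y → y ≈ 0# → x * y ≈ 0#
    *0 x y y0 = trans (*-congˡ y0) (zeroʳ x)

    0* : ∀ x y → x ≈ 0# → x * y ≈ 0#
    0* x y x0 = trans (*-congʳ x0) (zeroˡ y)

    sum-0 : ∀ {m} (f : Fin m → Carrier) → (∀ i → f i ≈ 0#) → ∑[ i < m ] f i ≈ 0#
    sum-0 {m} f f0 = trans (sum-cong-≋ f0) (sum-replicate-zero m)

    sum-lin : ∀ {m} a c (f g : Fin m → Carrier) →
              ∑[ i < m ] (a * f i + g i * c) ≈ a * (∑[ i < m ] f i) + (∑[ i < m ] g i) * c
    sum-lin a c f g = trans (∑-distrib-+ (λ i → a * f i) (λ i → g i * c))
      (+-cong (sym (*-distribˡ-sum a f)) (sym (*-distribʳ-sum c g)))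

    δ : ∀ {m} → Fin m → Fin m → Carrier
    δ x z = if does (x Fin.≟ z) then 1# else 0#

    δ-refl : ∀ {m} (x : Fin m) → δ x x ≈ 1#
    δ-refl x with x Fin.≟ x
    ... | yes _   = refl
    ... | no  x≢x = contradiction ≡.refl x≢x

    δ-≢ : ∀ {m} {x z : Fin m} → x ≢ z → δ x z ≈ 0#
    δ-≢ {x = x} {z} x≢z with x Fin.≟ z
    ... | yes x≡z = contradiction x≡z x≢z
    ... | no  _   = refl

    δ-∉ : ∀ {m} {S : Subset m} {x} → x ∈ S → SupportedOn S (δ x)
    δ-∉ {S = S} x∈S z z∉S = δ-≢ λ x≡z → z∉S (≡.subst (_∈ S) x≡z x∈S)

    sum-δ : ∀ {m} (x : Fin m) (f : Fin m → Carrier) → ∑[ z < m ] (δ x z * f z) ≈ f x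
    sum-δ {suc m} zero    f = trans (+-cong (*-identityˡ (f zero)) (sum-0 {m} _ λ i → zeroˡ (f (suc i)))) (+-identityʳ (f zero))
    sum-δ {suc m} (suc x) f = trans (+-cong (zeroˡ (f zero)) (sum-δ x (f ∘ suc))) (+-identityˡ (f (suc x)))

    -- A homogeneous linear system with unknowns J and equations I.
    OnlyTrivial : ∀ {m} → Subset m → Subset m → (Fin m → Fin m → Carrier) → Set
    OnlyTrivial {m} I J B = ∀ y → SupportedOn J y →
      (∀ i → i ∈ I → ∑[ x < m ] (y x * B x i) ≈ 0#) → ∀ x → y x ≈ 0#

    rearrange₁ : ∀ p y d s b → (p * y + d * s) * b ≈ p * (y * b) + (d * b) * s
    rearrange₁ p y d s b = trans (distribʳ b (p * y) (d * s)) (+-cong (*-assoc p y b)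
      (trans (*-assoc d s b) (trans (*-congˡ (*-comm s b)) (sym (*-assoc d b s)))))

    rearrange₂ : ∀ y p b c s → y * (p * b + c * s) ≈ p * (y * b) + (y * c) * s
    rearrange₂ y p b c s = trans (distribˡ y (p * b) (c * s)) (+-cong
      (trans (sym (*-assoc y p b)) (trans (*-congʳ (*-comm y p)) (*-assoc p y b)))
      (sym (*-assoc y c s)))

    swap-neg : ∀ b s → b * (- s) ≈ s * (- b)
    swap-neg b s = trans (sym (-‿distribʳ-* b s)) (trans (-‿cong (*-comm b s)) (-‿distribʳ-* s b))

    cancel-neg : ∀ b s → b * s + b * (- s) ≈ 0#
    cancel-neg b s = trans (sym (distribˡ b s (- s))) (*0 b _ (-‿inverseʳ s))

    pivot : ∀ {m} {I J : Subset m} {B} {i x} → x ∈ J → ¬ (B x i ≈ 0#) → OnlyTrivial I J B →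
            OnlyTrivial (I ∖ i) (J ∖ x) (λ z k → B x i * B z k + B z i * (- B x k))
    pivot {m} {I} {J} {B} {i} {x} x∈J p≉0 triv y supp eqs = y≈0
      where
      p = B x i
      s = ∑[ z < m ] (y z * B z i)
      T : Fin m → Carrier
      T k = ∑[ z < m ] (y z * B z k)
      y′ : Fin m → Carrier
      y′ z = p * y z + δ x z * (- s)
      sum-y′ : ∀ k → ∑[ z < m ] (y′ z * B z k) ≈ p * T k + B x k * (- s)
      sum-y′ k = begin
        ∑[ z < m ] (y′ z * B z k)
          ≈⟨ sum-cong-≋ (λ z → rearrange₁ p (y z) (δ x z) (- s) (B z k)) ⟩
        ∑[ z < m ] (p * (y z * B z k) + (δ x z * B z k) * (- s))
          ≈⟨ sum-lin p (- s) (λ z → y z * B z k) (λ z → δ x z * B z k) ⟩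
        p * T k + (∑[ z < m ] (δ x z * B z k)) * (- s)
          ≈⟨ +-congˡ (*-congʳ (sum-δ x (λ z → B z k))) ⟩
        p * T k + B x k * (- s) ∎
      reduced : ∀ k → k ∈ I ∖ i → p * T k + B x k * (- s) ≈ 0#
      reduced k k∈ = begin
        p * T k + B x k * (- s)
          ≈⟨ +-congˡ (swap-neg (B x k) s) ⟩
        p * T k + s * (- B x k)
          ≈⟨ sum-lin p (- B x k) (λ z → y z * B z k) (λ z → y z * B z i) ⟨
        ∑[ z < m ] (p * (y z * B z k) + (y z * B z i) * (- B x k))
          ≈⟨ sum-cong-≋ (λ z → rearrange₂ (y z) p (B z k) (B z i) (- B x k)) ⟨
        ∑[ z < m ] (y z * (p * B z k + B z i * (- B x k)))
          ≈⟨ eqs k k∈ ⟩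
        0# ∎
      y′≈0 : ∀ z → y′ z ≈ 0#
      y′≈0 = triv y′
        (λ z z∉J → 0*+ _ _ _ (*0 p _ (supp z (z∉J ∘ p─q⊆p J ⁅ x ⁆))) (δ-∉ x∈J z z∉J))
        λ k k∈I → trans (sum-y′ k) (equation k k∈I)
        where
        equation : ∀ k → k ∈ I → p * T k + B x k * (- s) ≈ 0#
        equation k k∈I with k Fin.≟ i
        ... | yes ≡.refl = cancel-neg p s
        ... | no  k≢i    = reduced k (x∈p∧x≢y⇒x∈p-y k∈I k≢i)
      y≈0 : ∀ z → y z ≈ 0#
      y≈0 z with x Fin.≟ z
      ... | yes ≡.refl = supp x (x∉p∖x J x)
      ... | no  x≢z    = cancel p (y z) p≉0 (begin
        p * y z                   ≈⟨ +-identityʳ _ ⟨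
        p * y z + 0#              ≈⟨ +-congˡ (0* _ (- s) (δ-≢ x≢z)) ⟨
        p * y z + δ x z * (- s)   ≈⟨ y′≈0 z ⟩
        0# ∎)

    underdetermined : ∀ n {m} (I J : Subset m) B → ∣ I ∣ ℕ.≤ n → ∣ I ∣ ℕ.< ∣ J ∣ →
                      ¬ OnlyTrivial I J B
    underdetermined n {m} I J B I≤n I<J triv with nonempty? I
    ... | no I-empty with nonempty? J
    ...   | no J-empty = ℕ.n≮0 (≡.subst (∣ I ∣ ℕ.<_)
              (≡.trans (≡.cong ∣_∣ (Empty-unique J-empty)) (∣⊥∣≡0 m)) I<J)
    ...   | yes (x , x∈J) = 1≉0 (trans (sym (δ-refl x))
              (triv (δ x) (δ-∉ x∈J) (λ i i∈I → contradiction (i , i∈I) I-empty) x))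
    underdetermined zero I J B I≤n I<J triv | yes (i , i∈I) =
      ℕ.n≮0 (ℕ.<-≤-trans (x∈p⇒∣p-x∣<∣p∣ i∈I) I≤n)
    underdetermined (suc n) {m} I J B I≤n I<J triv | yes (i , i∈I) =
      underdetermined n (I ∖ i) J B I∖i≤n (ℕ.<-trans I∖i<I I<J)
        λ y supp eqs → triv y supp (equation y supp eqs)
      where
      I∖i<I = x∈p⇒∣p-x∣<∣p∣ i∈I
      I∖i≤n = ℕ.≤-pred (ℕ.≤-trans I∖i<I I≤n)
      column≈0 : ∀ x → x ∈ J → B x i ≈ 0#
      column≈0 x x∈J = ≈0-stable _ λ p≉0 →
        underdetermined n (I ∖ i) (J ∖ x) _ I∖i≤n
          (ℕ.<-≤-trans I∖i<I (ℕ.≤-pred (ℕ.≤-trans I<J (∣p∣≤1+∣p∖x∣ J x))))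
          (pivot x∈J p≉0 triv)
      equation : ∀ y → SupportedOn J y → (∀ k → k ∈ I ∖ i → ∑[ x < m ] (y x * B x k) ≈ 0#) →
                 ∀ k → k ∈ I → ∑[ x < m ] (y x * B x k) ≈ 0#
      equation y supp eqs k k∈I with k Fin.≟ i
      ... | no  k≢i    = eqs k (x∈p∧x≢y⇒x∈p-y k∈I k≢i)
      ... | yes ≡.refl = sum-0 (λ x → y x * B x i) term
        where
        term : ∀ x → y x * B x i ≈ 0#
        term x with x ∈? J
        ... | yes x∈J = *0 _ _ (column≈0 x x∈J)
        ... | no  x∉J = 0* _ _ (supp x x∉J)

    module _ {m} {J : Set} (A : Fin m → J → Carrier) where

      -- A nonzero multiple of row x is a combination of the rows in I.
      InSpan : Subset m → Fin m → Set
      InSpan I x = ∃ λ d → ¬ (d ≈ 0#) × ∃ λ a → SupportedOn I a ×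
        (∀ j → d * A x j ≈ ∑[ i < m ] (a i * A i j))

      ¬indep⇒span : ∀ I x → RowsIndependent A I → ¬ RowsIndependent A (I ∪ ⁅ x ⁆) → ¬ ¬ InSpan I x
      ¬indep⇒span I x indI dep ¬span = dep λ c supp eqs →
        let cx≈0 : c x ≈ 0#
            cx≈0 = ≈0-stable _ λ cx≉0 → ¬span (c x , cx≉0 , a c , a-supp c supp , a-eq c eqs)
        in indI c (restrict c supp cx≈0) eqs
        where
        ∉∪ : ∀ {z} → z ∉ I → x ≢ z → z ∉ I ∪ ⁅ x ⁆
        ∉∪ z∉I x≢z z∈ = [ z∉I , (λ z∈x → x≢z (≡.sym (x∈⁅y⁆⇒x≡y x z∈x))) ]′ (x∈p∪q⁻ I ⁅ x ⁆ z∈)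
        restrict : ∀ c → SupportedOn (I ∪ ⁅ x ⁆) c → c x ≈ 0# → SupportedOn I c
        restrict c supp cx≈0 z z∉I with x Fin.≟ z
        ... | yes ≡.refl = cx≈0
        ... | no  x≢z    = supp z (∉∪ z∉I x≢z)
        a : (Fin m → Carrier) → Fin m → Carrier
        a c z = (- 1#) * c z + δ x z * c x
        a-supp : ∀ c → SupportedOn (I ∪ ⁅ x ⁆) c → SupportedOn I (a c)
        a-supp c supp z z∉I with x Fin.≟ z
        ... | yes ≡.refl = trans (sym (distribʳ (c x) (- 1#) 1#)) (0* _ _ (-‿inverseˡ 1#))
        ... | no  x≢z    = 0*+ _ _ _ (*0 _ _ (supp z (∉∪ z∉I x≢z))) refl
        a-eq : ∀ c → (∀ j → ∑[ e < m ] (c e * A e j) ≈ 0#) →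
               ∀ j → c x * A x j ≈ ∑[ z < m ] (a c z * A z j)
        a-eq c eqs j = sym (begin
          ∑[ z < m ] (a c z * A z j)
            ≈⟨ sum-cong-≋ (λ z → rearrange₁ (- 1#) (c z) (δ x z) (c x) (A z j)) ⟩
          ∑[ z < m ] ((- 1#) * (c z * A z j) + (δ x z * A z j) * c x)
            ≈⟨ sum-lin (- 1#) (c x) (λ z → c z * A z j) (λ z → δ x z * A z j) ⟩
          (- 1#) * (∑[ z < m ] (c z * A z j)) + (∑[ z < m ] (δ x z * A z j)) * c x
            ≈⟨ +-cong (*0 _ _ (eqs j)) (*-congʳ (sum-δ x (λ z → A z j))) ⟩
          0# + A x j * c x
            ≈⟨ +-identityˡ _ ⟩
          A x j * c x
            ≈⟨ *-comm _ _ ⟩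
          c x * A x j ∎)

      span-size : ∀ I S → RowsIndependent A S → (∀ x → x ∈ S → ¬ ¬ InSpan I x) → ¬ (∣ I ∣ ℕ.< ∣ S ∣)
      span-size I S indS spans I<S = ¬¬-∀ {Q = λ x → x ∈ S → InSpan I x} choose λ span →
        underdetermined ∣ I ∣ I S (coef span) ℕ.≤-refl I<S (trivial span)
        where
        choose : ∀ x → ¬ ¬ (x ∈ S → InSpan I x)
        choose x k with x ∈? S
        ... | yes x∈S = spans x x∈S λ sp → k λ _ → sp
        ... | no  x∉S = k λ x∈S → contradiction x∈S x∉S
        module _ (span : ∀ x → x ∈ S → InSpan I x) where
          total : ∀ x → ∃₂ λ d (a : Fin m → Carrier) → SupportedOn I a ×
            (x ∈ S → ¬ (d ≈ 0#) × (∀ j → d * A x j ≈ ∑[ i < m ] (a i * A i j)))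
          total x with x ∈? S
          ... | yes x∈S = let d , d≉0 , a , supp , eq = span x x∈S in d , a , supp , λ _ → d≉0 , eq
          ... | no  x∉S = 0# , (λ _ → 0#) , (λ _ _ → refl) , λ x∈S → contradiction x∈S x∉S
          d : Fin m → Carrier
          d x = proj₁ (total x)
          coef : Fin m → Fin m → Carrier
          coef x = proj₁ (proj₂ (total x))
          coef-supp : ∀ x → SupportedOn I (coef x)
          coef-supp x = proj₁ (proj₂ (proj₂ (total x)))
          total-eq : ∀ x → x ∈ S → ¬ (d x ≈ 0#) × (∀ j → d x * A x j ≈ ∑[ i < m ] (coef x i * A i j))
          total-eq x = proj₂ (proj₂ (proj₂ (total x)))
          trivial : OnlyTrivial I S coef
          trivial y supp eqs x with x ∈? S
          ... | no  x∉S = supp x x∉S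
          ... | yes x∈S = cancel (d x) (y x) (proj₁ (total-eq x x∈S))
                            (trans (*-comm _ _) (indS (λ z → y z * d z) (λ z z∉S → 0* _ _ (supp z z∉S)) relation x))
            where
            row : ∀ j z → (y z * d z) * A z j ≈ ∑[ i < m ] (y z * (coef z i * A i j))
            row j z = split (z ∈? S)
              where
              split : Dec (z ∈ S) → (y z * d z) * A z j ≈ ∑[ i < m ] (y z * (coef z i * A i j))
              split (yes z∈S) = trans (*-assoc _ _ _) (trans (*-congˡ (proj₂ (total-eq z z∈S) j))
                                  (*-distribˡ-sum (y z) (λ i → coef z i * A i j)))
              split (no  z∉S) = trans (0* _ _ (0* _ _ (supp z z∉S)))
                                  (sym (sum-0 (λ i → y z * (coef z i * A i j)) λ i → 0* _ _ (supp z z∉S)))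
            column : ∀ i → ∑[ z < m ] (y z * coef z i) ≈ 0#
            column i with i ∈? I
            ... | yes i∈I = eqs i i∈I
            ... | no  i∉I = sum-0 (λ z → y z * coef z i) λ z → *0 _ _ (coef-supp z i i∉I)
            relation : ∀ j → ∑[ z < m ] ((y z * d z) * A z j) ≈ 0#
            relation j = begin
              ∑[ z < m ] ((y z * d z) * A z j)
                ≈⟨ sum-cong-≋ (row j) ⟩
              ∑[ z < m ] ∑[ i < m ] (y z * (coef z i * A i j))
                ≈⟨ ∑-comm (λ z i → y z * (coef z i * A i j)) ⟩
              ∑[ i < m ] ∑[ z < m ] (y z * (coef z i * A i j))
                ≈⟨ sum-0 (λ i → ∑[ z < m ] (y z * (coef z i * A i j))) (λ i → begin
                     ∑[ z < m ] (y z * (coef z i * A i j))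
                       ≈⟨ sum-cong-≋ (λ z → *-assoc (y z) (coef z i) (A i j)) ⟨
                     ∑[ z < m ] ((y z * coef z i) * A i j)
                       ≈⟨ *-distribʳ-sum (A i j) (λ z → y z * coef z i) ⟨
                     (∑[ z < m ] (y z * coef z i)) * A i j
                       ≈⟨ 0* _ _ (column i) ⟩
                     0# ∎) ⟩
              0# ∎

  rowMatroid : ∀ {m} {J : Set} → Subset m → (Fin m → J → Carrier) → Matroid m
  rowMatroid E A = record
    { ground        = E
    ; Indep         = λ S → S ⊆ E × RowsIndependent A S
    ; indep⇒⊆ground = λ {I} → proj₁ {B = λ _ → RowsIndependent A I}
    ; indep-⊥       = (λ x∈⊥ → contradiction x∈⊥ ∉⊥) , λ c supp _ e → supp e ∉⊥
    ; indep-⊆       = λ I⊆J (J⊆E , indJ) →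
        (λ x∈I → J⊆E (I⊆J x∈I)) , λ c supp → indJ c λ e e∉J → supp e (e∉J ∘ I⊆J)
    ; augment       = λ {I} {S} (I⊆E , indI) (S⊆E , indS) I<S ¬aug →
        span-size A I S indS (λ x x∈S → spanned I S I⊆E indI S⊆E ¬aug x x∈S) I<S
    }
    where
    spanned : ∀ I S → I ⊆ E → RowsIndependent A I → S ⊆ E →
              ¬ (∃ λ x → x ∈ S × x ∉ I × (I ∪ ⁅ x ⁆ ⊆ E × RowsIndependent A (I ∪ ⁅ x ⁆))) →
              ∀ x → x ∈ S → ¬ ¬ InSpan A I x
    spanned I S I⊆E indI S⊆E ¬aug x x∈S with x ∈? I
    ... | yes x∈I = λ k → k (1# , 1≉0 , δ x , δ-∉ x∈I , λ j →
            trans (*-identityˡ _) (sym (sum-δ x (λ z → A z j))))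
    ... | no  x∉I = ¬indep⇒span A I x indI λ indIx → ¬aug (x , x∈S , x∉I ,
            (λ z∈ → [ I⊆E , (λ z∈x → ≡.subst (_∈ E) (≡.sym (x∈⁅y⁆⇒x≡y x z∈x)) (S⊆E x∈S)) ]′
                      (x∈p∪q⁻ I ⁅ x ⁆ z∈)) , indIx)

------------------------------------------------------------------------
-- The field ℝ: Cauchy sequences of rationals modulo null sequences.

open ≡ using (refl; sym; trans; cong; cong₂; subst)

Eventually : (ℕ → Set) → Set
Eventually P = ∃ λ N → ∀ n → N ℕ.≤ n → P n

Null : (ℕ → ℚ) → Set
Null s = ∀ ε → 0ℚ ℚ.< ε → Eventually λ n → ℚ.∣ s n ∣ ℚ.< ε

Cauchy : (ℕ → ℚ) → Set
Cauchy s = ∀ ε → 0ℚ ℚ.< ε →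
  ∃ λ N → ∀ m n → N ℕ.≤ m → N ℕ.≤ n → ℚ.∣ s m ℚ.- s n ∣ ℚ.< ε

record ℝ : Set where
  constructor mkℝ
  field
    seq    : ℕ → ℚ
    cauchy : Cauchy seq

open ℝ public

infix 4 _≃_

-- A record, so that the two reals can be inferred from a proof.
record _≃_ (x y : ℝ) : Set where
  constructor mk≃
  field null : Null (λ n → seq x n ℚ.- seq y n)

open _≃_ public

private
  both : ∀ {P Q R : ℕ → Set} → (∀ n → P n → Q n → R n) →
         Eventually P → Eventually Q → Eventually R
  both f (M , p) (N , q) = M ℕ.⊔ N , λ n le →
    f n (p n (ℕ.≤-trans (ℕ.m≤m⊔n M N) le)) (q n (ℕ.≤-trans (ℕ.m≤n⊔m M N) le))

  half-pos : ∀ {ε} → 0ℚ ℚ.< ε → 0ℚ ℚ.< ½ ℚ.* ε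
  half-pos 0<ε = ℚ.<-respˡ-≡ (ℚ.*-zeroʳ ½) (ℚ.*-monoʳ-<-pos ½ 0<ε)

  half+half : ∀ ε → ½ ℚ.* ε ℚ.+ ½ ℚ.* ε ≡ ε
  half+half ε = trans (sym (ℚ.*-distribʳ-+ ε ½ ½)) (ℚ.*-identityˡ ε)

  quotient : ∀ A ε → 0ℚ ℚ.< A → 0ℚ ℚ.< ε → ∃ λ δ → 0ℚ ℚ.< δ × A ℚ.* δ ≡ ε
  quotient A ε 0<A 0<ε = δ , 0<δ , Aδ≡ε
    where
    instance
      A-pos : ℚ.Positive A
      A-pos = ℚ.positive 0<A
      A-nz : ℚ.NonZero A
      A-nz = ℚ.pos⇒nonZero A
    δ = ℚ.1/ A ℚ.* ε
    instance
      1/A-pos : ℚ.Positive (ℚ.1/ A)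
      1/A-pos = ℚ.1/pos⇒pos A
    0<δ = ℚ.<-respˡ-≡ (ℚ.*-zeroʳ (ℚ.1/ A)) (ℚ.*-monoʳ-<-pos (ℚ.1/ A) 0<ε)
    Aδ≡ε : A ℚ.* δ ≡ ε
    Aδ≡ε = trans (sym (ℚ.*-assoc A (ℚ.1/ A) ε))
             (trans (cong (ℚ._* ε) (ℚ.*-inverseʳ A)) (ℚ.*-identityˡ ε))

  ∣+∣< : ∀ a b {α β} → ℚ.∣ a ∣ ℚ.< α → ℚ.∣ b ∣ ℚ.< β → ℚ.∣ a ℚ.+ b ∣ ℚ.< α ℚ.+ β
  ∣+∣< a b a< b< = ℚ.≤-<-trans (ℚ.∣p+q∣≤∣p∣+∣q∣ a b) (ℚ.+-mono-< a< b<)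

  ∣*∣< : ∀ a b {α β} → 0ℚ ℚ.< α → ℚ.∣ a ∣ ℚ.< α → ℚ.∣ b ∣ ℚ.< β →
         ℚ.∣ a ℚ.* b ∣ ℚ.< α ℚ.* β
  ∣*∣< a b {α} {β} 0<α a< b< = ℚ.≤-<-trans
    (ℚ.≤-trans (ℚ.≤-reflexive (ℚ.∣p*q∣≡∣p∣*∣q∣ a b))
      (ℚ.*-monoʳ-≤-nonNeg ℚ.∣ b ∣ (ℚ.<⇒≤ a<)))
    (ℚ.*-monoʳ-<-pos α b<)
    where
    instance
      α-pos : ℚ.Positive α
      α-pos = ℚ.positive 0<α
      b-nn : ℚ.NonNegative ℚ.∣ b ∣
      b-nn = ℚ.∣-∣-nonNeg b

  0<1 : 0ℚ ℚ.< 1ℚ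
  0<1 = ℚ.positive⁻¹ 1ℚ

  null-cong : ∀ {s t} → (∀ n → s n ≡ t n) → Null s → Null t
  null-cong eq ns ε 0<ε = let N , f = ns ε 0<ε in
    N , λ n le → subst (λ q → ℚ.∣ q ∣ ℚ.< ε) (eq n) (f n le)

  null-+ : ∀ {s t} → Null s → Null t → Null (λ n → s n ℚ.+ t n)
  null-+ {s} {t} ns nt ε 0<ε = both
    (λ n a b → ℚ.<-respʳ-≡ (half+half ε) (∣+∣< (s n) (t n) a b))
    (ns _ (half-pos 0<ε)) (nt _ (half-pos 0<ε))

  null-neg : ∀ {s} → Null s → Null (λ n → ℚ.- s n)
  null-neg {s} ns ε 0<ε = let N , f = ns ε 0<ε in
    N , λ n le → ℚ.<-respˡ-≡ (sym (ℚ.∣-p∣≡∣p∣ (s n))) (f n le)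

  Bounded : (ℕ → ℚ) → Set
  Bounded s = ∃ λ B → 0ℚ ℚ.< B × Eventually λ n → ℚ.∣ s n ∣ ℚ.< B

  bounded : ∀ x → Bounded (seq x)
  bounded x = B , 0<B , N , λ n le →
    ℚ.≤-<-trans
      (ℚ.≤-trans (ℚ.≤-reflexive (cong ℚ.∣_∣ (lemma (seq x n) (seq x N))))
                 (ℚ.∣p+q∣≤∣p∣+∣q∣ (seq x N) (seq x n ℚ.- seq x N)))
      (ℚ.+-monoʳ-< ℚ.∣ seq x N ∣ (f n N le ℕ.≤-refl))
    where
    N = proj₁ (cauchy x 1ℚ 0<1)
    f = proj₂ (cauchy x 1ℚ 0<1)
    B = ℚ.∣ seq x N ∣ ℚ.+ 1ℚ
    0<B : 0ℚ ℚ.< B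
    0<B = ℚ.<-respˡ-≡ (ℚ.+-identityˡ 0ℚ) (ℚ.+-mono-≤-< (ℚ.0≤∣p∣ (seq x N)) 0<1)
    open +-*-Solver
    lemma : ∀ a b → a ≡ b ℚ.+ (a ℚ.- b)
    lemma = solve 2 (λ a b → a := b :+ (a :- b)) refl

  null-* : ∀ {s t} → Bounded s → Null t → Null (λ n → s n ℚ.* t n)
  null-* {s} {t} (B , 0<B , bs) nt ε 0<ε with quotient B ε 0<B 0<ε
  ... | δ , 0<δ , refl = both (λ n → ∣*∣< (s n) (t n) 0<B) bs (nt δ 0<δ)

infixl 6 _+_
infixl 7 _*_
infix  8 -_

fromℚ : ℚ → ℝ
fromℚ q = mkℝ (λ _ → q) λ ε 0<ε → 0 , λ _ _ _ _ →
  ℚ.<-respˡ-≡ (sym (cong ℚ.∣_∣ (ℚ.+-inverseʳ q))) 0<ε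

0ℝ 1ℝ : ℝ
0ℝ = fromℚ 0ℚ
1ℝ = fromℚ 1ℚ

_+_ : ℝ → ℝ → ℝ
x + y = mkℝ (λ n → seq x n ℚ.+ seq y n) λ ε 0<ε →
  let M , f = cauchy x _ (half-pos 0<ε)
      N , g = cauchy y _ (half-pos 0<ε)
  in M ℕ.⊔ N , λ m n m≥ n≥ →
    subst (λ q → ℚ.∣ q ∣ ℚ.< ε)
      (lemma (seq x m) (seq x n) (seq y m) (seq y n))
      (ℚ.<-respʳ-≡ (half+half ε)
        (∣+∣< (seq x m ℚ.- seq x n) (seq y m ℚ.- seq y n)
          (f m n (ℕ.m⊔n≤o⇒m≤o M N m≥) (ℕ.m⊔n≤o⇒m≤o M N n≥))
          (g m n (ℕ.m⊔n≤o⇒n≤o M N m≥) (ℕ.m⊔n≤o⇒n≤o M N n≥))))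
  where
  open +-*-Solver
  lemma : ∀ a b c e → (a ℚ.- b) ℚ.+ (c ℚ.- e) ≡ (a ℚ.+ c) ℚ.- (b ℚ.+ e)
  lemma = solve 4 (λ a b c e → (a :- b) :+ (c :- e) := (a :+ c) :- (b :+ e)) refl

-_ : ℝ → ℝ
- x = mkℝ (λ n → ℚ.- seq x n) λ ε 0<ε →
  let N , f = cauchy x ε 0<ε in N , λ m n m≥ n≥ →
    subst (ℚ._< ε)
      (trans (sym (ℚ.∣-p∣≡∣p∣ (seq x m ℚ.- seq x n)))
             (cong ℚ.∣_∣ (ℚ.neg-distrib-+ (seq x m) (ℚ.- seq x n))))
      (f m n m≥ n≥)

private
  cauchy-* : ∀ {s t} → Bounded s → Bounded t → Cauchy s → Cauchy t →
             Cauchy (λ n → s n ℚ.* t n)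
  cauchy-* {s} {t} (A , 0<A , K , a) (B , 0<B , L , b) cs ct ε 0<ε =
    helper (quotient A _ 0<A (half-pos 0<ε)) (quotient B _ 0<B (half-pos 0<ε))
    where
    open +-*-Solver
    lemma : ∀ a b c e → a ℚ.* (c ℚ.- e) ℚ.+ e ℚ.* (a ℚ.- b) ≡ a ℚ.* c ℚ.- b ℚ.* e
    lemma = solve 4 (λ a b c e → a :* (c :- e) :+ e :* (a :- b) := a :* c :- b :* e) refl
    helper : (∃ λ δ → 0ℚ ℚ.< δ × A ℚ.* δ ≡ ½ ℚ.* ε) →
             (∃ λ η → 0ℚ ℚ.< η × B ℚ.* η ≡ ½ ℚ.* ε) →
             ∃ λ N → ∀ m n → N ℕ.≤ m → N ℕ.≤ n →
               ℚ.∣ s m ℚ.* t m ℚ.- s n ℚ.* t n ∣ ℚ.< ε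
    helper (δ , 0<δ , eδ) (η , 0<η , eη) =
      let M , f = ct δ 0<δ
          N , g = cs η 0<η
      in (K ℕ.⊔ L) ℕ.⊔ (M ℕ.⊔ N) , λ m n m≥ n≥ →
      let m₁ = ℕ.m⊔n≤o⇒m≤o (K ℕ.⊔ L) (M ℕ.⊔ N) m≥
          m₂ = ℕ.m⊔n≤o⇒n≤o (K ℕ.⊔ L) (M ℕ.⊔ N) m≥
          n₁ = ℕ.m⊔n≤o⇒m≤o (K ℕ.⊔ L) (M ℕ.⊔ N) n≥
          n₂ = ℕ.m⊔n≤o⇒n≤o (K ℕ.⊔ L) (M ℕ.⊔ N) n≥
      in subst (λ q → ℚ.∣ q ∣ ℚ.< ε) (lemma (s m) (s n) (t m) (t n))
        (ℚ.<-respʳ-≡ (trans (cong₂ ℚ._+_ eδ eη) (half+half ε))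
          (∣+∣< (s m ℚ.* (t m ℚ.- t n)) (t n ℚ.* (s m ℚ.- s n))
            (∣*∣< (s m) (t m ℚ.- t n) 0<A
              (a m (ℕ.m⊔n≤o⇒m≤o K L m₁))
              (f m n (ℕ.m⊔n≤o⇒m≤o M N m₂) (ℕ.m⊔n≤o⇒m≤o M N n₂)))
            (∣*∣< (t n) (s m ℚ.- s n) 0<B
              (b n (ℕ.m⊔n≤o⇒n≤o K L n₁))
              (g m n (ℕ.m⊔n≤o⇒n≤o M N m₂) (ℕ.m⊔n≤o⇒n≤o M N n₂)))))

_*_ : ℝ → ℝ → ℝ
x * y = mkℝ (λ n → seq x n ℚ.* seq y n)
            (cauchy-* (bounded x) (bounded y) (cauchy x) (cauchy y))

private
  pointwise : ∀ {x y} → (∀ n → seq x n ≡ seq y n) → x ≃ y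
  pointwise {x} {y} eq = mk≃ λ ε 0<ε → 0 , λ n _ →
    ℚ.<-respˡ-≡ (sym (cong ℚ.∣_∣ (trans (cong (ℚ._- seq y n) (eq n)) (ℚ.+-inverseʳ (seq y n))))) 0<ε

  ≃-sym : ∀ {x y} → x ≃ y → y ≃ x
  ≃-sym {x} {y} (mk≃ p) = mk≃ (null-cong (λ n → lemma (seq x n) (seq y n)) (null-neg p))
    where
    open +-*-Solver
    lemma : ∀ a b → ℚ.- (a ℚ.- b) ≡ b ℚ.- a
    lemma = solve 2 (λ a b → :- (a :- b) := b :- a) refl

  ≃-trans : ∀ {x y z} → x ≃ y → y ≃ z → x ≃ z
  ≃-trans {x} {y} {z} (mk≃ p) (mk≃ q) =
    mk≃ (null-cong (λ n → lemma (seq x n) (seq y n) (seq z n)) (null-+ p q))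
    where
    open +-*-Solver
    lemma : ∀ a b c → (a ℚ.- b) ℚ.+ (b ℚ.- c) ≡ a ℚ.- c
    lemma = solve 3 (λ a b c → (a :- b) :+ (b :- c) := a :- c) refl

  +-cong : ∀ {x y u v} → x ≃ y → u ≃ v → x + u ≃ y + v
  +-cong {x} {y} {u} {v} (mk≃ p) (mk≃ q) = mk≃
    (null-cong (λ n → lemma (seq x n) (seq y n) (seq u n) (seq v n)) (null-+ p q))
    where
    open +-*-Solver
    lemma : ∀ a b c e → (a ℚ.- b) ℚ.+ (c ℚ.- e) ≡ (a ℚ.+ c) ℚ.- (b ℚ.+ e)
    lemma = solve 4 (λ a b c e → (a :- b) :+ (c :- e) := (a :+ c) :- (b :+ e)) refl

  -‿cong : ∀ {x y} → x ≃ y → - x ≃ - y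
  -‿cong {x} {y} (mk≃ p) = mk≃
    (null-cong (λ n → ℚ.neg-distrib-+ (seq x n) (ℚ.- seq y n)) (null-neg p))

  *-cong : ∀ {x y u v} → x ≃ y → u ≃ v → x * u ≃ y * v
  *-cong {x} {y} {u} {v} (mk≃ p) (mk≃ q) = mk≃
    (null-cong (λ n → lemma (seq x n) (seq y n) (seq u n) (seq v n))
      (null-+ (null-* (bounded x) q) (null-* (bounded v) p)))
    where
    open +-*-Solver
    lemma : ∀ a b c e → a ℚ.* (c ℚ.- e) ℚ.+ e ℚ.* (a ℚ.- b) ≡ a ℚ.* c ℚ.- b ℚ.* e
    lemma = solve 4 (λ a b c e → a :* (c :- e) :+ e :* (a :- b) := a :* c :- b :* e) refl

ℝ-commutativeRing : CommutativeRing 0ℓ 0ℓ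
ℝ-commutativeRing = record
  { Carrier = ℝ ; _≈_ = _≃_ ; _+_ = _+_ ; _*_ = _*_ ; -_ = -_ ; 0# = 0ℝ ; 1# = 1ℝ
  ; isCommutativeRing = record
    { isRing = record
      { +-isAbelianGroup = record
        { isGroup = record
          { isMonoid = record
            { isSemigroup = record
              { isMagma = record
                { isEquivalence = record
                  { refl = pointwise λ _ → refl ; sym = ≃-sym ; trans = ≃-trans }
                ; ∙-cong = +-cong
                }
              ; assoc = λ x y z → pointwise λ n → ℚ.+-assoc (seq x n) (seq y n) (seq z n)
              }
            ; identity = (λ x → pointwise λ n → ℚ.+-identityˡ (seq x n))
                       , (λ x → pointwise λ n → ℚ.+-identityʳ (seq x n))
            }
          ; inverse = (λ x → pointwise λ n → ℚ.+-inverseˡ (seq x n))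
                    , (λ x → pointwise λ n → ℚ.+-inverseʳ (seq x n))
          ; ⁻¹-cong = -‿cong
          }
        ; comm = λ x y → pointwise λ n → ℚ.+-comm (seq x n) (seq y n)
        }
      ; *-cong = *-cong
      ; *-assoc = λ x y z → pointwise λ n → ℚ.*-assoc (seq x n) (seq y n) (seq z n)
      ; *-identity = (λ x → pointwise λ n → ℚ.*-identityˡ (seq x n))
                   , (λ x → pointwise λ n → ℚ.*-identityʳ (seq x n))
      ; distrib = (λ x y z → pointwise λ n → ℚ.*-distribˡ-+ (seq x n) (seq y n) (seq z n))
                , (λ x y z → pointwise λ n → ℚ.*-distribʳ-+ (seq x n) (seq y n) (seq z n))
      }
    ; *-comm = λ x y → pointwise λ n → ℚ.*-comm (seq x n) (seq y n)
    }
  }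

private
  ≃0⇒null : ∀ {x} → x ≃ 0ℝ → Null (seq x)
  ≃0⇒null {x} (mk≃ p) = null-cong (λ n → ℚ.+-identityʳ (seq x n)) p

  null⇒≃0 : ∀ {x} → Null (seq x) → x ≃ 0ℝ
  null⇒≃0 {x} p = mk≃ (null-cong (λ n → sym (ℚ.+-identityʳ (seq x n))) p)

  small-or-away : ∀ y ε → 0ℚ ℚ.< ε →
    (Eventually λ n → ℚ.∣ seq y n ∣ ℚ.< ε) ⊎
    (∃ λ δ → 0ℚ ℚ.< δ × Eventually λ n → δ ℚ.≤ ℚ.∣ seq y n ∣)
  small-or-away y ε 0<ε with cauchy y (½ ℚ.* (½ ℚ.* ε)) (half-pos (half-pos 0<ε))
  ... | N , f with ℚ.∣ seq y N ∣ ℚ.<? ½ ℚ.* ε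
  ... | yes small = inj₁ (N , λ n le →
    ℚ.<-respˡ-≡ (cong ℚ.∣_∣ (lemma (seq y N) (seq y n)))
      (ℚ.<-respʳ-≡ (half+half ε)
        (∣+∣< (seq y N) (seq y n ℚ.- seq y N) small
          (ℚ.<-trans (f n N le ℕ.≤-refl) quarter<half))))
    where
    h = ½ ℚ.* ε
    open +-*-Solver
    lemma : ∀ a b → a ℚ.+ (b ℚ.- a) ≡ b
    lemma = solve 2 (λ a b → a :+ (b :- a) := b) refl
    quarter<half : ½ ℚ.* h ℚ.< h
    quarter<half = ℚ.<-respˡ-≡ (ℚ.+-identityʳ (½ ℚ.* h))
      (ℚ.<-respʳ-≡ (half+half h) (ℚ.+-monoʳ-< (½ ℚ.* h) (half-pos (half-pos 0<ε))))
  ... | no large = inj₂ (½ ℚ.* h , half-pos (half-pos 0<ε) , N , λ n le →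
    ℚ.≮⇒≥ λ yn< → large
      (ℚ.<-respˡ-≡ (cong ℚ.∣_∣ (lemma (seq y N) (seq y n)))
        (ℚ.<-respʳ-≡ (half+half h)
          (∣+∣< (seq y n) (seq y N ℚ.- seq y n) yn< (f N n ℕ.≤-refl le)))))
    where
    h = ½ ℚ.* ε
    open +-*-Solver
    lemma : ∀ a b → b ℚ.+ (a ℚ.- b) ≡ a
    lemma = solve 2 (λ a b → b :+ (a :- b) := a) refl

≃0-stable : ∀ x → ¬ ¬ (x ≃ 0ℝ) → x ≃ 0ℝ
≃0-stable x ¬¬x≃0 = null⇒≃0 λ ε 0<ε → [ (λ z → z) , (λ where
  (δ , 0<δ , N , f) → ⊥-elim $ ¬¬x≃0 λ x≃0 →
    let M , g = ≃0⇒null x≃0 δ 0<δ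
        n     = M ℕ.⊔ N
    in ℚ.<-irrefl refl (ℚ.≤-<-trans (f n (ℕ.m≤n⊔m M N)) (g n (ℕ.m≤m⊔n M N)))) ]′
  (small-or-away x ε 0<ε)

*-cancel-≄0 : ∀ x y → ¬ (x ≃ 0ℝ) → x * y ≃ 0ℝ → y ≃ 0ℝ
*-cancel-≄0 x y x≄0 xy≃0 = null⇒≃0 λ ε 0<ε → [ (λ z → z) , (λ where
  (δ , 0<δ , away) → ⊥-elim $ x≄0 $ null⇒≃0 (x-null δ 0<δ away)) ]′
  (small-or-away y ε 0<ε)
  where
  x-null : ∀ δ → 0ℚ ℚ.< δ → Eventually (λ n → δ ℚ.≤ ℚ.∣ seq y n ∣) → Null (seq x)
  x-null δ 0<δ away ε 0<ε = both
    (λ n δ≤ xy< → ℚ.*-cancelʳ-<-nonNeg δ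
      (ℚ.≤-<-trans (step n δ≤) (ℚ.<-respʳ-≡ (ℚ.*-comm δ ε) xy<)))
    away
    (≃0⇒null xy≃0 (δ ℚ.* ε) (ℚ.<-respˡ-≡ (ℚ.*-zeroʳ δ) (ℚ.*-monoʳ-<-pos δ 0<ε)))
    where
    instance
      δ-pos : ℚ.Positive δ
      δ-pos = ℚ.positive 0<δ
      δ-nn : ℚ.NonNegative δ
      δ-nn = ℚ.pos⇒nonNeg δ
    step : ∀ n → δ ℚ.≤ ℚ.∣ seq y n ∣ → ℚ.∣ seq x n ∣ ℚ.* δ ℚ.≤ ℚ.∣ seq x n ℚ.* seq y n ∣
    step n δ≤ = ℚ.≤-trans
      (ℚ.*-monoˡ-≤-nonNeg ℚ.∣ seq x n ∣ {{ℚ.∣-∣-nonNeg (seq x n)}} δ≤)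
      (ℚ.≤-reflexive (sym (ℚ.∣p*q∣≡∣p∣*∣q∣ (seq x n) (seq y n))))

1≄0 : ¬ (1ℝ ≃ 0ℝ)
1≄0 1≃0 = let N , f = ≃0⇒null 1≃0 1ℚ 0<1 in ℚ.<-irrefl refl (f N ℕ.≤-refl)

ℝ-isDomain : IsDomain ℝ-commutativeRing
ℝ-isDomain = record { 1≉0 = 1≄0 ; ≈0-stable = ≃0-stable ; cancel = *-cancel-≄0 }

open RowMatroid ℝ-commutativeRing ℝ-isDomain public

------------------------------------------------------------------------

-- ℚ[X₁,…,Xₙ₊₁] as polynomials in X₁ over ℚ[X₂,…,Xₙ₊₁], given by their
-- coefficients, constant term first.
Poly : ℕ → Set
Poly zero    = ℚ
Poly (suc n) = List (Poly n)

IsZero : ∀ n → Poly n → Set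
IsZero zero    q  = q ≡ 0ℚ
IsZero (suc n) fs = All (IsZero n) fs

eval : ∀ n → Poly n → Vector ℝ n → ℝ
eval zero    q        x = fromℚ q
eval (suc n) []       x = 0ℝ
eval (suc n) (f ∷ fs) x = eval n f (tail x) + head x * eval (suc n) fs x

AlgebraicallyIndependent : {I : Set} → (I → ℝ) → Set
AlgebraicallyIndependent {I} x =
  ∀ k (ι : Fin k → I) → Injective _≡_ _≡_ ι →
  ∀ f → eval k f (x ∘ ι) ≃ 0ℝ → IsZero k f

------------------------------------------------------------------------
-- Finite simple graphs with vertices among the labels Fin n.  The edge joining
-- u and v, where u < v, is combine u v : Fin (n * n).

source target : ∀ n → Fin (n ℕ.* n) → Fin n
source n e = proj₁ (remQuot {n} n e)
target n e = proj₂ (remQuot {n} n e)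

record Graph (n : ℕ) : Set where
  field
    V             : Subset n
    E             : Subset (n ℕ.* n)
    source<target : ∀ {e} → e ∈ E → source n e Fin.< target n e
    source∈V      : ∀ {e} → e ∈ E → source n e ∈ V
    target∈V      : ∀ {e} → e ∈ E → target n e ∈ V

open Graph public

Vertex : ∀ {n} → Graph n → Set
Vertex G = ∃ λ v → v ∈ V G

Adjacent : ∀ {n} (G : Graph n) → Vertex G → Vertex G → Set
Adjacent G (u , _) (v , _) = combine u v ∈ E G ⊎ combine v u ∈ E G

infix 4 _≅_

record _≅_ {m n} (G : Graph m) (H : Graph n) : Set where
  field
    vertices : Vertex G ↔ Vertex H
    adjacent : ∀ u v →
      Adjacent G u v ⇔ Adjacent H (Inverse.to vertices u) (Inverse.to vertices v)

K₂ : Graph 2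
K₂ = record
  { V             = ⊤
  ; E             = ⁅ edge ⁆
  ; source<target = λ e∈ → subst (λ e → source 2 e Fin.< target 2 e)
                             (sym (x∈⁅y⁆⇒x≡y edge e∈)) (ℕ.s≤s ℕ.z≤n)
  ; source∈V      = λ _ → ∈⊤
  ; target∈V      = λ _ → ∈⊤
  }
  where
  edge : Fin 4
  edge = combine {2} {2} 0F 1F

infixr 7 _∩ᴳ_
infixr 6 _∪ᴳ_

_∪ᴳ_ : ∀ {n} → Graph n → Graph n → Graph n
G₁ ∪ᴳ G₂ = record
  { V             = V G₁ ∪ V G₂
  ; E             = E G₁ ∪ E G₂
  ; source<target = λ e∈ → [ source<target G₁ , source<target G₂ ]′ (split e∈)
  ; source∈V      = λ e∈ → x∈p∪q⁺ (Sum.map (source∈V G₁) (source∈V G₂) (split e∈))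
  ; target∈V      = λ e∈ → x∈p∪q⁺ (Sum.map (target∈V G₁) (target∈V G₂) (split e∈))
  }
  where
  split : ∀ {e} → e ∈ E G₁ ∪ E G₂ → e ∈ E G₁ ⊎ e ∈ E G₂
  split = x∈p∪q⁻ (E G₁) (E G₂)

_∩ᴳ_ : ∀ {n} → Graph n → Graph n → Graph n
G₁ ∩ᴳ G₂ = record
  { V             = V G₁ ∩ V G₂
  ; E             = E G₁ ∩ E G₂
  ; source<target = λ e∈ → source<target G₁ (proj₁ (split e∈))
  ; source∈V      = λ e∈ → x∈p∩q⁺ (Product.map (source∈V G₁) (source∈V G₂) (split e∈))
  ; target∈V      = λ e∈ → x∈p∩q⁺ (Product.map (target∈V G₁) (target∈V G₂) (split e∈))
  }
  where
  split : ∀ {e} → e ∈ E G₁ ∩ E G₂ → e ∈ E G₁ × e ∈ E G₂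
  split = x∈p∩q⁻ (E G₁) (E G₂)

infixl 5 _∖ᴳ_

_∖ᴳ_ : ∀ {n} → Graph n → Fin (n ℕ.* n) → Graph n
G ∖ᴳ e = record
  { V             = V G
  ; E             = E G ∖ e
  ; source<target = λ f∈ → source<target G (p─q⊆p (E G) ⁅ e ⁆ f∈)
  ; source∈V      = λ f∈ → source∈V G (p─q⊆p (E G) ⁅ e ⁆ f∈)
  ; target∈V      = λ f∈ → target∈V G (p─q⊆p (E G) ⁅ e ⁆ f∈)
  }

graphicalParallelConnection : ∀ {n} → Graph n → Graph n → Graph n
graphicalParallelConnection G₁ G₂ = G₁ ∪ᴳ G₂

graphical2Sum : ∀ {n} → Graph n → Graph n → Fin (n ℕ.* n) → Graph n
graphical2Sum G₁ G₂ e = (G₁ ∪ᴳ G₂) ∖ᴳ e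

------------------------------------------------------------------------
-- A map p : V → ℝᵈ is given by values at all labels in Fin n; those at labels
-- outside V are never used.

Generic : ∀ {n d} → Graph n → (Fin n → Vector ℝ d) → Set
Generic {d = d} G p = AlgebraicallyIndependent coordinate
  where
  coordinate : Vertex G × Fin d → ℝ
  coordinate ((v , _) , k) = p v k

rigidityMatrix : ∀ {n d} (G : Graph n) → (Fin n → Vector ℝ d) →
                 Fin (n ℕ.* n) → Vertex G × Fin d → ℝ
rigidityMatrix {n} G p e ((w , _) , k) =
  if does (w Fin.≟ u) then p u k + - p v k else
  if does (w Fin.≟ v) then p v k + - p u k else
  0ℝ
  where
  u = source n e
  v = target n e

-- The rigidity matroid at p, which is the generic one when Generic G p holds.
ℛ : ∀ {n d} (G : Graph n) → (Fin n → Vector ℝ d) → Matroid (n ℕ.* n)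
ℛ G p = rowMatroid (E G) (rigidityMatrix G p)

{-# OPTIONS --safe #-}
module Submission where

-- Independence of rows at a generic point depends only on which rational
-- polynomials vanish there, hence not on the generic point, so all matroids may
-- be taken at one generic p of the union.  Split a relation among the rows of
-- G₁ ∪ G₂ into its parts on E₁ and on E₂.  The two parts give opposite forces,
-- acting only on V₁ ∩ V₂ = {u, v}; balance of forces and of torques makes them
-- proportional to row e.  So, up to scaling, every relation of G₁ ∪ G₂ is the
-- sum of a relation of G₁ and one of G₂, which may differ from its two parts
-- at e only, and this determines the circuits.

import Defs
open import Defs using
  ( Matroid; ground; Indep; Circuit; GluedCircuit; IsDomain; module RowMatroid
  ; Coloop; Loop; Gluable; IsParallelConnection; Is2Sum; Poly; IsZero
  ; Graph; Vertex; V; E; source; target; source<target; source∈V; target∈V; _≅_; K₂; _∪ᴳ_; _∩ᴳ_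
  ; graphicalParallelConnection; graphical2Sum)
open import Level using (0ℓ)
open import Algebra.Bundles using (CommutativeRing)
import Algebra.Properties.CommutativeSemigroup as CommutativeSemigroupProperties
import Algebra.Properties.Ring as RingProperties
import Algebra.Properties.Semiring.Sum as SemiringSum
open import Data.Bool.Base using (true; false; if_then_else_)
open import Data.Fin.Base as Fin using (Fin; zero; suc)
import Data.Fin.Properties as Fin
open import Data.Fin.Subset renaming (_-_ to infixl 5 _∖_)
open import Data.Fin.Subset.Properties
open import Data.List.Base as List using ([]; _∷_)
open import Data.List.Relation.Unary.All using ([]; _∷_)
open import Data.Nat.Base as ℕ using (ℕ; zero; suc; _≤_)
import Data.Nat.Properties as ℕ
open import Data.Product as Product using (∃; ∃₂; _×_; _,_; proj₁; proj₂)
open import Data.Rational.Base as ℚ using (ℚ; 0ℚ; 1ℚ)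
open import Data.Sum.Base as Sum using (_⊎_; inj₁; inj₂; [_,_]′)
open import Data.Vec.Base using ([]; _∷_; here; there)
open import Data.Vec.Functional using (Vector; head; tail)
open import Data.Vec.Properties.WithK using ([]=-irrelevant)
open import Function.Base using (_∘_; _$_)
open import Function.Bundles using (_⇔_; mk⇔; Equivalence; Inverse)
open import Function.Definitions using (Injective)
import Relation.Binary.Reasoning.Setoid as SetoidReasoning
open import Relation.Binary.PropositionalEquality as ≡ using (_≡_; _≢_)
open import Relation.Nullary using (¬_; Dec; yes; no; does; contradiction)

-- The obstacle is constructive. Over the reals, equality with zero is undecidable, though stable
-- under double negation, and there is only the structure of an integral domain to work with. So
-- nothing is divided: proportionality is cross-multiplied, identities carry a nonzero scale, and
-- elimination replaces entries by minors. Moreover, dependence is the negation of a universal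
-- statement, so a circuit hands over no nonzero relation. The usual "take a nonzero relation and
-- eliminate `e`" is therefore turned round: some coefficient is assumed to be nonzero, a set known
-- to be dependent is shown to be independent, and stability gives the conclusion. Membership in a
-- finite subset is decidable, which is what permits case distinctions on where an element lies.

x∈p─q⇒x∉q : ∀ {m} {p q : Subset m} {x} → x ∈ p ─ q → x ∉ q
x∈p─q⇒x∉q {p = _ ∷ p} {_ ∷ q} (there x∈) (there x∈q) = x∈p─q⇒x∉q {p = p} x∈ x∈q

x∈p∖y⇒x≢y : ∀ {m} {p : Subset m} {x y} → x ∈ p ∖ y → x ≢ y
x∈p∖y⇒x≢y {p = p} x∈ = x∉⁅y⁆⇒x≢y (x∈p─q⇒x∉q {p = p} x∈)

─-empty⇒⊆ : ∀ {m} {p q : Subset m} → Empty (p ─ q) → p ⊆ q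
─-empty⇒⊆ {q = q} empty {x} x∈p with x ∈? q
... | yes x∈q = x∈q
... | no  x∉q = contradiction (x , x∈p∧x∉q⇒x∈p─q x∈p x∉q) empty

-- Linear algebra over an integral domain.

module DomainLinearAlgebra (R : CommutativeRing 0ℓ 0ℓ) (domain : IsDomain R) where

  open CommutativeRing R hiding (zero)
  open IsDomain domain
  open RowMatroid R domain
  open RingProperties ring using (-‿distribˡ-*; -‿distribʳ-*; +-inverseʳ-unique; ⁻¹-anti-homo‿-)
  open SemiringSum semiring
    using (sum-syntax; sum-cong-≋; sum-replicate-zero; ∑-distrib-+; ∑-comm; *-distribˡ-sum; *-distribʳ-sum)
  open SetoidReasoning setoid

  x≈0⇒x*y≈0 : ∀ {x} y → x ≈ 0# → x * y ≈ 0#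
  x≈0⇒x*y≈0 y x≈0 = trans (*-congʳ x≈0) (zeroˡ y)

  y≈0⇒x*y≈0 : ∀ x {y} → y ≈ 0# → x * y ≈ 0#
  y≈0⇒x*y≈0 x y≈0 = trans (*-congˡ y≈0) (zeroʳ x)

  x≈0∧y≈0⇒x+y≈0 : ∀ {x y} → x ≈ 0# → y ≈ 0# → x + y ≈ 0#
  x≈0∧y≈0⇒x+y≈0 x≈0 y≈0 = trans (+-cong x≈0 y≈0) (+-identityˡ 0#)

  y≈0⇒x+y≈x : ∀ x {y} → y ≈ 0# → x + y ≈ x
  y≈0⇒x+y≈x x y≈0 = trans (+-congˡ y≈0) (+-identityʳ x)

  x≈0⇒x+y≈y : ∀ {x} y → x ≈ 0# → x + y ≈ y
  x≈0⇒x+y≈y y x≈0 = trans (+-congʳ x≈0) (+-identityˡ y)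

  x*y+-y*x≈0 : ∀ x y → x * y + (- y) * x ≈ 0#
  x*y+-y*x≈0 x y = begin
    x * y + (- y) * x   ≈⟨ +-congˡ (-‿distribˡ-* y x) ⟨
    x * y + - (y * x)   ≈⟨ +-congˡ (-‿cong (*-comm y x)) ⟩
    x * y + - (x * y)   ≈⟨ -‿inverseʳ _ ⟩
    0# ∎

  sum-zero : ∀ {m} {f : Fin m → Carrier} → (∀ i → f i ≈ 0#) → ∑[ i < m ] f i ≈ 0#
  sum-zero {m} f≈0 = trans (sum-cong-≋ f≈0) (sum-replicate-zero m)

  δ : ∀ {m} → Fin m → Fin m → Carrier
  δ x z = if does (x Fin.≟ z) then 1# else 0#

  δ-refl : ∀ {m} (x : Fin m) → δ x x ≈ 1#
  δ-refl x with x Fin.≟ x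
  ... | yes _   = refl
  ... | no  x≢x = contradiction ≡.refl x≢x

  δ-≢ : ∀ {m} {x z : Fin m} → x ≢ z → δ x z ≈ 0#
  δ-≢ {x = x} {z} x≢z with x Fin.≟ z
  ... | yes x≡z = contradiction x≡z x≢z
  ... | no  _   = refl

  sum-δ : ∀ {m} (x : Fin m) (f : Fin m → Carrier) → ∑[ z < m ] (δ x z * f z) ≈ f x
  sum-δ {suc m} zero    f = trans (+-cong (*-identityˡ (f zero)) (sum-zero λ i → zeroˡ (f (suc i)))) (+-identityʳ (f zero))
  sum-δ {suc m} (suc x) f = trans (+-cong (zeroˡ (f zero)) (sum-δ x (f ∘ suc))) (+-identityˡ (f (suc x)))

  sum-combination : ∀ {m} a b (c c′ f : Fin m → Carrier) →
    ∑[ z < m ] ((a * c z + b * c′ z) * f z) ≈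
    a * (∑[ z < m ] (c z * f z)) + b * (∑[ z < m ] (c′ z * f z))
  sum-combination {m} a b c c′ f = begin
    ∑[ z < m ] ((a * c z + b * c′ z) * f z)
      ≈⟨ sum-cong-≋ (λ z → trans (distribʳ (f z) _ _) (+-cong (*-assoc a _ _) (*-assoc b _ _))) ⟩
    ∑[ z < m ] (a * (c z * f z) + b * (c′ z * f z))
      ≈⟨ ∑-distrib-+ (λ z → a * (c z * f z)) (λ z → b * (c′ z * f z)) ⟩
    ∑[ z < m ] (a * (c z * f z)) + ∑[ z < m ] (b * (c′ z * f z))
      ≈⟨ +-cong (*-distribˡ-sum a (λ z → c z * f z)) (*-distribˡ-sum b (λ z → c′ z * f z)) ⟨
    a * (∑[ z < m ] (c z * f z)) + b * (∑[ z < m ] (c′ z * f z)) ∎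

  -- Relations among rows, and pivoting.

  module _ {m : ℕ} {J : Set} where

    Relation : (Fin m → J → Carrier) → (Fin m → Carrier) → Set
    Relation A c = ∀ j → ∑[ e < m ] (c e * A e j) ≈ 0#

    relation-combination : ∀ {A c c′} a b → Relation A c → Relation A c′ →
                           Relation A (λ z → a * c z + b * c′ z)
    relation-combination {A} {c} {c′} a b rel rel′ j =
      trans (sum-combination a b c c′ (λ z → A z j))
            (x≈0∧y≈0⇒x+y≈0 (y≈0⇒x*y≈0 a (rel j)) (y≈0⇒x*y≈0 b (rel′ j)))

    independent-⊆ : ∀ {A : Fin m → J → Carrier} {S T} → S ⊆ T → RowsIndependent A T → RowsIndependent A S
    independent-⊆ S⊆T ind c supp = ind c λ z z∉T → supp z (z∉T ∘ S⊆T)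

    singleton-independent : ∀ {A : Fin m → J → Carrier} {e} j → ¬ (A e j ≈ 0#) → RowsIndependent A ⁅ e ⁆
    singleton-independent {A} {e} j Aej≉0 c supp rel z with e Fin.≟ z
    ... | no  e≢z    = supp z λ z∈ → e≢z (≡.sym (x∈⁅y⁆⇒x≡y e z∈))
    ... | yes ≡.refl = cancel (A e j) (c e) Aej≉0 (begin
      A e j * c e                         ≈⟨ *-comm _ _ ⟩
      c e * A e j                         ≈⟨ sum-δ e (λ y → c y * A y j) ⟨
      ∑[ y < m ] (δ e y * (c y * A y j))  ≈⟨ sum-cong-≋ term ⟩
      ∑[ y < m ] (c y * A y j)            ≈⟨ rel j ⟩
      0# ∎)
      where
      term : ∀ y → δ e y * (c y * A y j) ≈ c y * A y j
      term y with e Fin.≟ y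
      ... | yes _   = *-identityˡ _
      ... | no  e≢y = trans (zeroˡ _) (sym (x≈0⇒x*y≈0 _ (supp y λ y∈ → e≢y (≡.sym (x∈⁅y⁆⇒x≡y e y∈)))))

    -- The 2 by 2 minor on rows `x`, `z` and columns `j`, `k`: pivoting at `(x , j)` without
    -- division. Row `x` and column `j` become zero.
    eliminate : (Fin m → J → Carrier) → Fin m → J → Fin m → J → Carrier
    eliminate A x j z k = A x j * A z k + A z j * (- A x k)

    sum-eliminate : ∀ A x j c k → ∑[ z < m ] (c z * eliminate A x j z k) ≈
      A x j * (∑[ z < m ] (c z * A z k)) + (∑[ z < m ] (c z * A z j)) * (- A x k)
    sum-eliminate A x j c k = begin
      ∑[ z < m ] (c z * eliminate A x j z k)
        ≈⟨ sum-cong-≋ (λ z → term (c z) (A x j) (A z k) (A z j) (- A x k)) ⟩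
      ∑[ z < m ] ((A x j * A z k + (- A x k) * A z j) * c z)
        ≈⟨ sum-combination (A x j) (- A x k) (λ z → A z k) (λ z → A z j) c ⟩
      A x j * (∑[ z < m ] (A z k * c z)) + (- A x k) * (∑[ z < m ] (A z j * c z))
        ≈⟨ +-cong (*-congˡ (sum-cong-≋ λ z → *-comm (A z k) (c z)))
                  (trans (*-comm _ _) (*-congʳ (sum-cong-≋ λ z → *-comm (A z j) (c z)))) ⟩
      A x j * (∑[ z < m ] (c z * A z k)) + (∑[ z < m ] (c z * A z j)) * (- A x k) ∎
      where
      term : ∀ c p a b q → c * (p * a + b * q) ≈ (p * a + q * b) * c
      term c p a b q = trans (*-comm _ _) (*-congʳ (+-congˡ (*-comm b q)))

    eliminate-independent : ∀ {A x j S} → x ∈ S → ¬ (A x j ≈ 0#) → RowsIndependent A S →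
                            RowsIndependent (eliminate A x j) (S ∖ x)
    eliminate-independent {A} {x} {j} {S} x∈S p≉0 ind c supp rel = c≈0
      where
      p = A x j
      s = ∑[ z < m ] (c z * A z j)
      -- The coefficient `- s` given to row `x` is the one that makes column `j` cancel, since the
      -- scaled rest contributes `p * s` there.
      c′ : Fin m → Carrier
      c′ z = p * c z + (- s) * δ x z
      c′-supp : SupportedOn S c′
      c′-supp z z∉S = x≈0∧y≈0⇒x+y≈0 (y≈0⇒x*y≈0 p (supp z (z∉S ∘ p─q⊆p S ⁅ x ⁆)))
        (y≈0⇒x*y≈0 _ (δ-≢ λ x≡z → z∉S (≡.subst (_∈ S) x≡z x∈S)))
      c′-rel : Relation A c′
      c′-rel k = begin
        ∑[ z < m ] (c′ z * A z k)
          ≈⟨ sum-combination p (- s) c (δ x) (λ z → A z k) ⟩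
        p * (∑[ z < m ] (c z * A z k)) + (- s) * (∑[ z < m ] (δ x z * A z k))
          ≈⟨ +-congˡ (*-congˡ (sum-δ x (λ z → A z k))) ⟩
        p * (∑[ z < m ] (c z * A z k)) + (- s) * A x k
          ≈⟨ +-congˡ (trans (sym (-‿distribˡ-* s _)) (-‿distribʳ-* s _)) ⟩
        p * (∑[ z < m ] (c z * A z k)) + s * (- A x k)
          ≈⟨ sum-eliminate A x j c k ⟨
        ∑[ z < m ] (c z * eliminate A x j z k)
          ≈⟨ rel k ⟩
        0# ∎
      c≈0 : ∀ z → c z ≈ 0#
      c≈0 z with x Fin.≟ z
      ... | yes ≡.refl = supp x λ x∈ → x∈p∖y⇒x≢y {p = S} x∈ ≡.refl
      ... | no  x≢z    = cancel p (c z) p≉0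
        (trans (sym (y≈0⇒x+y≈x _ (y≈0⇒x*y≈0 _ (δ-≢ x≢z)))) (ind c′ c′-supp c′-rel z))

    -- The eliminated row `x` is zero, so a relation stays a relation when its coefficient at `x` is
    -- dropped. Hence all other coefficients vanish, and the nonzero pivot forces the one at `x` to
    -- vanish too.
    independent-eliminate : ∀ {A x j S} → ¬ (A x j ≈ 0#) →
                            RowsIndependent (eliminate A x j) (S ∖ x) → RowsIndependent A S
    independent-eliminate {A} {x} {j} {S} p≉0 ind c supp rel = c≈0
      where
      p = A x j
      c′ : Fin m → Carrier
      c′ z = if does (x Fin.≟ z) then 0# else c z
      c′-supp : SupportedOn (S ∖ x) c′
      c′-supp z z∉ with x Fin.≟ z
      ... | yes _   = refl
      ... | no  x≢z = supp z λ z∈S → z∉ (x∈p∧x≢y⇒x∈p-y z∈S (x≢z ∘ ≡.sym))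
      c′-term : ∀ k z → c′ z * eliminate A x j z k ≈ c z * eliminate A x j z k
      c′-term k z with x Fin.≟ z
      ... | no  _      = refl
      ... | yes ≡.refl = trans (zeroˡ _) (sym (y≈0⇒x*y≈0 _ (trans (+-congˡ (sym (-‿distribʳ-* p _))) (-‿inverseʳ _))))
      c′-rel : Relation (eliminate A x j) c′
      c′-rel k = begin
        ∑[ z < m ] (c′ z * eliminate A x j z k)
          ≈⟨ sum-cong-≋ (c′-term k) ⟩
        ∑[ z < m ] (c z * eliminate A x j z k)
          ≈⟨ sum-eliminate A x j c k ⟩
        p * (∑[ z < m ] (c z * A z k)) + (∑[ z < m ] (c z * A z j)) * (- A x k)
          ≈⟨ x≈0∧y≈0⇒x+y≈0 (y≈0⇒x*y≈0 p (rel k)) (x≈0⇒x*y≈0 _ (rel j)) ⟩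
        0# ∎
      rest≈0 : ∀ {z} → x ≢ z → c z ≈ 0#
      rest≈0 {z} x≢z with ind c′ c′-supp c′-rel z
      ... | c′z≈0 with x Fin.≟ z
      ... | yes x≡z = contradiction x≡z x≢z
      ... | no  _   = c′z≈0
      c≈0 : ∀ z → c z ≈ 0#
      c≈0 = singleton-independent j p≉0 c
        (λ z z∉ → rest≈0 λ x≡z → z∉ (≡.subst (_∈ ⁅ x ⁆) x≡z (x∈⁅x⁆ x))) rel

    -- Fraction-free Gaussian elimination of the two matrices in parallel.
    independent-transfer :
      (_∼_ : Carrier → Carrier → Set) →
      (∀ {x x′} → x ∼ x′ → x′ ≈ 0# → x ≈ 0#) →
      (∀ {x x′ y y′} → x ∼ x′ → y ∼ y′ → (x + y) ∼ (x′ + y′)) →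
      (∀ {x x′ y y′} → x ∼ x′ → y ∼ y′ → (x * y) ∼ (x′ * y′)) →
      (∀ {x x′} → x ∼ x′ → (- x) ∼ (- x′)) →
      ∀ {A A′ S} → (∀ e → e ∈ S → ∀ j → A e j ∼ A′ e j) →
      RowsIndependent A S → RowsIndependent A′ S
    independent-transfer _∼_ ∼-zero ∼-+ ∼-* ∼-neg {S = S} = go ∣ S ∣ ℕ.≤-refl
      where
      go : ∀ b {A A′ S} → ∣ S ∣ ℕ.≤ b → (∀ e → e ∈ S → ∀ j → A e j ∼ A′ e j) →
           RowsIndependent A S → RowsIndependent A′ S
      go b {S = S} S≤b A∼A′ ind c supp rel z with nonempty? S
      ... | no  empty = supp z λ z∈S → empty (z , z∈S)
      go zero    S≤b A∼A′ ind c supp rel z | yes (x , x∈S) =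
        contradiction (ℕ.<-≤-trans (x∈p⇒∣p-x∣<∣p∣ x∈S) S≤b) ℕ.n≮0
      go (suc b) {A} {A′} {S} S≤b A∼A′ ind c supp rel z | yes (x , x∈S) =
        -- A pivot cannot be searched for, as `J` is arbitrary and zero is undecidable. But if `c z`
        -- were nonzero, then by `pivot` no entry of row `x` of `A` could be nonzero; that row would
        -- vanish and `δ x` would be a relation on `S`.
        ≈0-stable _ λ cz≉0 → 1≉0 $ trans (sym (δ-refl x)) $
          ind (δ x) (λ y y∉S → δ-≢ λ x≡y → y∉S (≡.subst (_∈ S) x≡y x∈S))
            (λ j → trans (sum-δ x (λ y → A y j)) (≈0-stable _ (cz≉0 ∘ pivot j))) x
        where
        pivot : ∀ j → ¬ (A x j ≈ 0#) → c z ≈ 0#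
        pivot j p≉0 = independent-eliminate (p≉0 ∘ ∼-zero (A∼A′ x x∈S j))
          (go b (ℕ.≤-pred (ℕ.≤-trans (x∈p⇒∣p-x∣<∣p∣ x∈S) S≤b))
            (λ y y∈ k → let y∈S = p─q⊆p S ⁅ x ⁆ y∈ in
              ∼-+ (∼-* (A∼A′ x x∈S j) (A∼A′ y y∈S k)) (∼-* (A∼A′ y y∈S j) (∼-neg (A∼A′ x x∈S k))))
            (eliminate-independent x∈S p≉0 ind))
          c supp rel z

    -- Splitting a relation along one row.

    -- Up to a nonzero scale, a relation among the rows in S is the sum of one
    -- among the rows in S₁ and one among the rows in S₂.
    record Splitting (A : Fin m → J → Carrier) (c : Fin m → Carrier) (S₁ S₂ : Subset m) : Set where
      field
        scale      : Carrier
        scale≉0    : ¬ (scale ≈ 0#)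
        part₁      : Fin m → Carrier
        part₂      : Fin m → Carrier
        supported₁ : SupportedOn S₁ part₁
        supported₂ : SupportedOn S₂ part₂
        relation₁  : Relation A part₁
        relation₂  : Relation A part₂
        sum≈       : ∀ z → scale * c z ≈ part₁ z + part₂ z

    SplitsAlong : (Fin m → J → Carrier) → Fin m → Subset m → Subset m → Set
    SplitsAlong A e E₁ E₂ = ∀ {S c} → S ⊆ E₁ ∪ E₂ → SupportedOn S c → Relation A c →
      Splitting A c ((S ∩ E₁) ∪ ⁅ e ⁆) ((S ∩ E₂) ∪ ⁅ e ⁆)

    splitsAlong-swap : ∀ {A e E₁ E₂} → SplitsAlong A e E₁ E₂ → SplitsAlong A e E₂ E₁
    splitsAlong-swap {E₁ = E₁} {E₂} split S⊆ supp rel = record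
      { scale      = scale
      ; scale≉0    = scale≉0
      ; part₁      = part₂
      ; part₂      = part₁
      ; supported₁ = supported₂
      ; supported₂ = supported₁
      ; relation₁  = relation₂
      ; relation₂  = relation₁
      ; sum≈       = λ z → trans (sum≈ z) (+-comm _ _)
      }
      where open Splitting (split (λ x∈S → x∈p∪q⁺ (Sum.swap (x∈p∪q⁻ E₂ E₁ (S⊆ x∈S)))) supp rel)

    -- If two linear combinations of rows in E₁ and of rows in E₂ cancel, then
    -- their common value is, up to a nonzero scale, a multiple of row e.
    SpansMeetInRow : (Fin m → J → Carrier) → Fin m → Subset m → Subset m → Set
    SpansMeetInRow A e E₁ E₂ = ∀ c₁ c₂ → SupportedOn E₁ c₁ → SupportedOn E₂ c₂ →
      (∀ j → ∑[ z < m ] (c₁ z * A z j) + ∑[ z < m ] (c₂ z * A z j) ≈ 0#) →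
      ∃₂ λ d t → ¬ (d ≈ 0#) × (∀ j → d * (∑[ z < m ] (c₁ z * A z j)) ≈ t * A e j)

    -- Cut `c` into two pieces. After scaling by `d`, the first combines to `t` times row `e` and
    -- the second to its negative, so moving `t` copies of row `e` from the first to the second
    -- turns both into relations.
    spansMeetInRow⇒splitsAlong : ∀ {A e E₁ E₂} → SpansMeetInRow A e E₁ E₂ → SplitsAlong A e E₁ E₂
    spansMeetInRow⇒splitsAlong {A} {e} {E₁} {E₂} meet {S} {c} S⊆ supp rel = record
      { scale      = d
      ; scale≉0    = d≉0
      ; part₁      = part₁
      ; part₂      = part₂
      ; supported₁ = λ z z∉ → x≈0∧y≈0⇒x+y≈0
          (y≈0⇒x*y≈0 d (c₁-supp z (z∉ ∘ x∈p∪q⁺ ∘ inj₁))) (y≈0⇒x*y≈0 _ (δ≈0 (S ∩ E₁) z∉))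
      ; supported₂ = λ z z∉ → x≈0∧y≈0⇒x+y≈0
          (y≈0⇒x*y≈0 d (c₂-supp z (z∉ ∘ x∈p∪q⁺ ∘ inj₁))) (y≈0⇒x*y≈0 _ (δ≈0 (S ∩ E₂) z∉))
      ; relation₁  = relation₁
      ; relation₂  = relation₂
      ; sum≈       = λ z → begin
          d * c z
            ≈⟨ *-congˡ (c≈c₁+c₂ z) ⟩
          d * (c₁ z + c₂ z)
            ≈⟨ distribˡ d _ _ ⟩
          d * c₁ z + d * c₂ z
            ≈⟨ +-congʳ (y≈0⇒x+y≈x _ (trans (sym (distribʳ (δ e z) (- t) t)) (x≈0⇒x*y≈0 _ (-‿inverseˡ t)))) ⟨
          (d * c₁ z + ((- t) * δ e z + t * δ e z)) + d * c₂ z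
            ≈⟨ +-congʳ (+-assoc _ _ _) ⟨
          ((d * c₁ z + (- t) * δ e z) + t * δ e z) + d * c₂ z
            ≈⟨ +-assoc _ _ _ ⟩
          (d * c₁ z + (- t) * δ e z) + (t * δ e z + d * c₂ z)
            ≈⟨ +-congˡ (+-comm _ _) ⟩
          part₁ z + part₂ z ∎
      }
      where
      -- An element of both `E₁` and `E₂` is counted in `c₁` only, so that the pieces add up to `c`.
      c₁ c₂ : Fin m → Carrier
      c₁ z = if does (z ∈? E₁) then c z else 0#
      c₂ z = if does (z ∈? E₁) then 0# else c z
      c≈c₁+c₂ : ∀ z → c z ≈ c₁ z + c₂ z
      c≈c₁+c₂ z with z ∈? E₁
      ... | yes _ = sym (+-identityʳ _)
      ... | no  _ = sym (+-identityˡ _)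
      c₁-supp : SupportedOn (S ∩ E₁) c₁
      c₁-supp z z∉ with z ∈? E₁
      ... | yes z∈E₁ = supp z λ z∈S → z∉ (x∈p∩q⁺ (z∈S , z∈E₁))
      ... | no  _    = refl
      c₂-supp : SupportedOn (S ∩ E₂) c₂
      c₂-supp z z∉ with z ∈? E₁
      ... | yes _    = refl
      ... | no  z∉E₁ = supp z λ z∈S → z∉ (x∈p∩q⁺ (z∈S ,
                         [ (λ z∈E₁ → contradiction z∈E₁ z∉E₁) , (λ z∈E₂ → z∈E₂) ]′ (x∈p∪q⁻ E₁ E₂ (S⊆ z∈S))))
      r₁ r₂ : J → Carrier
      r₁ j = ∑[ z < m ] (c₁ z * A z j)
      r₂ j = ∑[ z < m ] (c₂ z * A z j)
      r₁+r₂≈0 : ∀ j → r₁ j + r₂ j ≈ 0#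
      r₁+r₂≈0 j = begin
        r₁ j + r₂ j
          ≈⟨ ∑-distrib-+ (λ z → c₁ z * A z j) (λ z → c₂ z * A z j) ⟨
        ∑[ z < m ] (c₁ z * A z j + c₂ z * A z j)
          ≈⟨ sum-cong-≋ (λ z → trans (*-congʳ (c≈c₁+c₂ z)) (distribʳ (A z j) _ _)) ⟨
        ∑[ z < m ] (c z * A z j)
          ≈⟨ rel j ⟩
        0# ∎
      common = meet c₁ c₂ (λ z z∉ → c₁-supp z (z∉ ∘ p∩q⊆q S E₁)) (λ z z∉ → c₂-supp z (z∉ ∘ p∩q⊆q S E₂)) r₁+r₂≈0
      d = proj₁ common
      t = proj₁ (proj₂ common)
      d≉0 = proj₁ (proj₂ (proj₂ common))
      dr₁≈tAe = proj₂ (proj₂ (proj₂ common))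
      part₁ part₂ : Fin m → Carrier
      part₁ z = d * c₁ z + (- t) * δ e z
      part₂ z = d * c₂ z + t * δ e z
      δ≈0 : ∀ T {z} → z ∉ T ∪ ⁅ e ⁆ → δ e z ≈ 0#
      δ≈0 T {z} z∉ = δ-≢ {x = e} {z} λ where ≡.refl → z∉ (x∈p∪q⁺ {p = T} (inj₂ (x∈⁅x⁆ e)))
      relation₁ : Relation A part₁
      relation₁ j = begin
        ∑[ z < m ] (part₁ z * A z j)
          ≈⟨ sum-combination d (- t) c₁ (δ e) (λ z → A z j) ⟩
        d * r₁ j + (- t) * (∑[ z < m ] (δ e z * A z j))
          ≈⟨ +-cong (dr₁≈tAe j) (*-congˡ (sum-δ e (λ z → A z j))) ⟩
        t * A e j + (- t) * A e j
          ≈⟨ distribʳ (A e j) t (- t) ⟨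
        (t + - t) * A e j
          ≈⟨ x≈0⇒x*y≈0 _ (-‿inverseʳ t) ⟩
        0# ∎
      relation₂ : Relation A part₂
      relation₂ j = begin
        ∑[ z < m ] (part₂ z * A z j)
          ≈⟨ sum-combination d t c₂ (δ e) (λ z → A z j) ⟩
        d * r₂ j + t * (∑[ z < m ] (δ e z * A z j))
          ≈⟨ +-congˡ (trans (*-congˡ (sum-δ e (λ z → A z j))) (sym (dr₁≈tAe j))) ⟩
        d * r₂ j + d * r₁ j
          ≈⟨ distribˡ d _ _ ⟨
        d * (r₂ j + r₁ j)
          ≈⟨ y≈0⇒x*y≈0 d (trans (+-comm _ _) (r₁+r₂≈0 j)) ⟩
        0# ∎

    supportedOn-∪⁅⁆ : ∀ (T : Subset m) e {c} → SupportedOn (T ∪ ⁅ e ⁆) c → c e ≈ 0# → SupportedOn T c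
    supportedOn-∪⁅⁆ T e supp ce≈0 z z∉T with e Fin.≟ z
    ... | yes ≡.refl = ce≈0
    ... | no  e≢z    = supp z λ z∈ → [ z∉T , (λ z∈e → e≢z (≡.sym (x∈⁅y⁆⇒x≡y e z∈e))) ]′ (x∈p∪q⁻ T ⁅ e ⁆ z∈)

    -- Minimal dependent sets when relations split along row `e`.

    Minimal : (Fin m → J → Carrier) → Subset m → Set
    Minimal A C = ∀ D → D ⊂ C → RowsIndependent A D

    module _ {A : Fin m → J → Carrier} {e : Fin m} {E₁ E₂ : Subset m}
             (meet : ∀ {x} → x ∈ E₁ → x ∈ E₂ → x ≡ e)
             (split : SplitsAlong A e E₁ E₂) where

      -- Only one side needs `e` adjoined. Its independence kills `part₁`, so `part₂` is the scaled
      -- `c`; this vanishes at `e` because `e` is not in `S`, which leaves a relation on `S ∩ E₂`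
      -- alone.
      join-independent : ∀ {S} → S ⊆ E₁ ∪ E₂ → e ∉ S → RowsIndependent A ((S ∩ E₁) ∪ ⁅ e ⁆) →
                         RowsIndependent A (S ∩ E₂) → RowsIndependent A S
      join-independent S⊆ e∉S ind₁ ind₂ c supp rel z =
        cancel scale (c z) scale≉0 (trans (scale*c≈part₂ z)
          (ind₂ part₂ (supportedOn-∪⁅⁆ _ e supported₂ part₂e≈0) relation₂ z))
        where
        open Splitting (split S⊆ supp rel)
        scale*c≈part₂ : ∀ y → scale * c y ≈ part₂ y
        scale*c≈part₂ y = trans (sum≈ y) (x≈0⇒x+y≈y _ (ind₁ part₁ supported₁ relation₁ y))
        part₂e≈0 : part₂ e ≈ 0#
        part₂e≈0 = trans (sym (scale*c≈part₂ e)) (y≈0⇒x*y≈0 scale (supp e e∉S))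

      join-independent-∈ : ∀ {S} → S ⊆ E₁ ∪ E₂ → e ∈ S → RowsIndependent A (S ∩ E₁) →
                           RowsIndependent A (S ∩ E₂) → e ∈ E₁ → e ∈ E₂ → RowsIndependent A S
      join-independent-∈ {S} S⊆ e∈S ind₁ ind₂ e∈E₁ e∈E₂ c supp rel z =
        cancel scale (c z) scale≉0 (trans (sum≈ z) (x≈0∧y≈0⇒x+y≈0
          (ind₁ part₁ (λ y y∉ → supported₁ y (y∉ ∘ absorb e∈E₁)) relation₁ z)
          (ind₂ part₂ (λ y y∉ → supported₂ y (y∉ ∘ absorb e∈E₂)) relation₂ z)))
        where
        open Splitting (split S⊆ supp rel)
        absorb : ∀ {E y} → e ∈ E → y ∈ (S ∩ E) ∪ ⁅ e ⁆ → y ∈ S ∩ E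
        absorb {E} e∈E y∈ with x∈p∪q⁻ (S ∩ E) ⁅ e ⁆ y∈
        ... | inj₁ y∈S∩E = y∈S∩E
        ... | inj₂ y∈e with x∈⁅y⁆⇒x≡y e y∈e
        ...   | ≡.refl = x∈p∩q⁺ (e∈S , e∈E)

      -- Even with `e` adjoined, `D ∩ E₁` misses `f`, and `D ∩ E₂` misses `e`. So the two are proper
      -- subsets of `C₁` and `C₂`, and `join-independent` applies.
      glued-independent : ∀ {C₁ C₂ D f} → C₁ ⊆ E₁ → C₂ ⊆ E₂ → e ∈ C₁ → e ∈ C₂ →
        Minimal A C₁ → Minimal A C₂ → D ⊆ C₁ ∪ C₂ → e ∉ D → f ∈ C₁ → f ≢ e → f ∉ D →
        RowsIndependent A D
      glued-independent {C₁} {C₂} {D} {f} C₁⊆E₁ C₂⊆E₂ e∈C₁ e∈C₂ min₁ min₂ D⊆ e∉D f∈C₁ f≢e f∉D =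
        join-independent (x∈p∪q⁺ ∘ Sum.map C₁⊆E₁ C₂⊆E₂ ∘ x∈p∪q⁻ C₁ C₂ ∘ D⊆) e∉D
          (min₁ _ (D∩E₁∪e⊆C₁ , f , f∈C₁ , f∉D∩E₁∪e))
          (min₂ _ (D∩E₂⊆C₂ , e , e∈C₂ , e∉D ∘ p∩q⊆p D E₂))
        where
        D∩E₁∪e⊆C₁ : (D ∩ E₁) ∪ ⁅ e ⁆ ⊆ C₁
        D∩E₁∪e⊆C₁ x∈ with x∈p∪q⁻ (D ∩ E₁) ⁅ e ⁆ x∈
        ... | inj₂ x∈e = ≡.subst (_∈ C₁) (≡.sym (x∈⁅y⁆⇒x≡y e x∈e)) e∈C₁
        ... | inj₁ x∈D∩E₁ with x∈p∩q⁻ D E₁ x∈D∩E₁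
        ...   | x∈D , x∈E₁ = [ (λ x∈C₁ → x∈C₁) ,
                (λ x∈C₂ → ≡.subst (_∈ C₁) (≡.sym (meet x∈E₁ (C₂⊆E₂ x∈C₂))) e∈C₁) ]′ (x∈p∪q⁻ C₁ C₂ (D⊆ x∈D))
        f∉D∩E₁∪e : f ∉ (D ∩ E₁) ∪ ⁅ e ⁆
        f∉D∩E₁∪e f∈ = [ f∉D ∘ p∩q⊆p D E₁ , f≢e ∘ x∈⁅y⁆⇒x≡y e ]′ (x∈p∪q⁻ (D ∩ E₁) ⁅ e ⁆ f∈)
        D∩E₂⊆C₂ : D ∩ E₂ ⊆ C₂
        D∩E₂⊆C₂ x∈ with x∈p∩q⁻ D E₂ x∈
        ... | x∈D , x∈E₂ = [ (λ x∈C₁ → ≡.subst (_∈ C₂) (≡.sym (meet (C₁⊆E₁ x∈C₁) x∈E₂)) e∈C₂) ,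
                (λ x∈C₂ → x∈C₂) ]′ (x∈p∪q⁻ C₁ C₂ (D⊆ x∈D))

      -- Circuit elimination at `e`. For relations `c` on `C₁` and `b` on `C₂`, the combination
      -- `b e * c - c e * b` vanishes at `e`. If it vanishes everywhere and `b e` is nonzero, then
      -- `c` vanishes off `e`, where the two sets are disjoint, and `ind-e` removes its coefficient
      -- at `e`.
      glued-dependent : ∀ {C₁ C₂} → C₁ ⊆ E₁ → C₂ ⊆ E₂ → RowsIndependent A ⁅ e ⁆ → e ∈ C₁ → e ∈ C₂ →
        ¬ RowsIndependent A C₁ → ¬ RowsIndependent A C₂ → Minimal A C₂ →
        ¬ RowsIndependent A ((C₁ ∪ C₂) ∖ e)
      glued-dependent {C₁} {C₂} C₁⊆E₁ C₂⊆E₂ ind-e e∈C₁ e∈C₂ dep₁ dep₂ min₂ ind =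
        -- Under the provisional assumption that `b x` is nonzero, every relation `c` on `C₁` is
        -- shown to vanish, against `dep₁`. Here `b e` is nonzero because otherwise `b` would be a
        -- relation on the independent set `C₂ ∖ e`.
        dep₂ λ b b-supp b-rel x → ≈0-stable _ λ bx≉0 → dep₁ λ c c-supp c-rel →
          let be≉0 : ¬ (b e ≈ 0#)
              be≉0 be≈0 = bx≉0 (min₂ (C₂ ∖ e) (x∈p⇒p-x⊂p e∈C₂) b
                (λ z z∉ → supportedOn-∖ b-supp be≈0 z z∉) b-rel x)
              w≈0 = ind (λ z → b e * c z + (- c e) * b z) (w-supp b b-supp c c-supp)
                (relation-combination (b e) (- c e) c-rel b-rel)
          in ind-e c (λ z z∉ → c-off-e b b-supp c c-supp be≉0 w≈0 z λ z≡e →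
               z∉ (≡.subst (_∈ ⁅ e ⁆) (≡.sym z≡e) (x∈⁅x⁆ e))) c-rel
        where
        supportedOn-∖ : ∀ {T : Subset m} {c x} → SupportedOn T c → c x ≈ 0# → SupportedOn (T ∖ x) c
        supportedOn-∖ {x = x} supp cx≈0 z z∉ with x Fin.≟ z
        ... | yes ≡.refl = cx≈0
        ... | no  x≢z    = supp z λ z∈T → z∉ (x∈p∧x≢y⇒x∈p-y z∈T (x≢z ∘ ≡.sym))
        w-supp : ∀ b → SupportedOn C₂ b → ∀ c → SupportedOn C₁ c →
                 SupportedOn ((C₁ ∪ C₂) ∖ e) (λ z → b e * c z + (- c e) * b z)
        w-supp b b-supp c c-supp = supportedOn-∖ {T = C₁ ∪ C₂}
          (λ z z∉ → x≈0∧y≈0⇒x+y≈0 (y≈0⇒x*y≈0 _ (c-supp z (z∉ ∘ x∈p∪q⁺ ∘ inj₁)))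
                                   (y≈0⇒x*y≈0 _ (b-supp z (z∉ ∘ x∈p∪q⁺ ∘ inj₂))))
          (x*y+-y*x≈0 (b e) (c e))
        c-off-e : ∀ b → SupportedOn C₂ b → ∀ c → SupportedOn C₁ c → ¬ (b e ≈ 0#) →
                  (∀ z → b e * c z + (- c e) * b z ≈ 0#) → ∀ z → z ≢ e → c z ≈ 0#
        c-off-e b b-supp c c-supp be≉0 w≈0 z z≢e with z ∈? C₁
        ... | no  z∉C₁ = c-supp z z∉C₁
        ... | yes z∈C₁ = cancel (b e) (c z) be≉0 (trans (sym (y≈0⇒x+y≈x _
              (y≈0⇒x*y≈0 _ (b-supp z λ z∈C₂ → z≢e (meet (C₁⊆E₁ z∈C₁) (C₂⊆E₂ z∈C₂)))))) (w≈0 z))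

      module _ {C : Subset m} {f₁ f₂ : Fin m} (C⊆ : C ⊆ E₁ ∪ E₂) (dep : ¬ RowsIndependent A C) (min : Minimal A C)
               (f₁∈C : f₁ ∈ C) (f₁∉E₁ : f₁ ∉ E₁) (f₂∈C : f₂ ∈ C) (f₂∉E₂ : f₂ ∉ E₂) where

        C∩E₁-independent : RowsIndependent A (C ∩ E₁)
        C∩E₁-independent = min (C ∩ E₁) (p∩q⊆p C E₁ , f₁ , f₁∈C , f₁∉E₁ ∘ p∩q⊆q C E₁)

        C∩E₂-independent : RowsIndependent A (C ∩ E₂)
        C∩E₂-independent = min (C ∩ E₂) (p∩q⊆p C E₂ , f₂ , f₂∈C , f₂∉E₂ ∘ p∩q⊆q C E₂)

        gluing-∉-circuit : e ∈ E₁ → e ∈ E₂ → e ∉ C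
        gluing-∉-circuit e∈E₁ e∈E₂ e∈C = dep (join-independent-∈ C⊆ e∈C C∩E₁-independent C∩E₂-independent e∈E₁ e∈E₂)

        half-dependent : e ∉ C → ¬ RowsIndependent A ((C ∩ E₁) ∪ ⁅ e ⁆)
        half-dependent e∉C ind = dep (join-independent C⊆ e∉C ind C∩E₂-independent)

        -- If `g` is `e`, then `D` lies in `C ∩ E₁`. Otherwise a nonzero relation `b` on `D` must
        -- involve `e`, so it expresses row `e`, up to scale, by rows of `C ∩ E₁` other than `g`.
        -- Substituting this for row `e` in the second part of any relation on `C` gives a relation
        -- on `C ∖ g`, hence zero; from this `C` would be independent.
        half-minimal : e ∉ C → RowsIndependent A ⁅ e ⁆ → Minimal A ((C ∩ E₁) ∪ ⁅ e ⁆)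
        half-minimal e∉C ind-e D (D⊆ , g , g∈ , g∉D) = cases (x∈p∪q⁻ (C ∩ E₁) ⁅ e ⁆ g∈)
          where
          cases : g ∈ C ∩ E₁ ⊎ g ∈ ⁅ e ⁆ → RowsIndependent A D
          cases (inj₂ g∈e) = independent-⊆ D⊆C∩E₁ C∩E₁-independent
            where
            e∉D : e ∉ D
            e∉D = g∉D ∘ ≡.subst (_∈ D) (≡.sym (x∈⁅y⁆⇒x≡y e g∈e))
            D⊆C∩E₁ : D ⊆ C ∩ E₁
            D⊆C∩E₁ {x} x∈D = [ (λ x∈ → x∈) , (λ x∈e →
              contradiction (≡.subst (_∈ D) (x∈⁅y⁆⇒x≡y e x∈e) x∈D) e∉D) ]′ (x∈p∪q⁻ (C ∩ E₁) ⁅ e ⁆ (D⊆ x∈D))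
          cases (inj₁ g∈C∩E₁) b b-supp b-rel x = ≈0-stable _ λ bx≉0 →
            dep (C-independent λ be≈0 → bx≉0 (C∩E₁-independent b (supportedOn-∪⁅⁆ _ e b-supp′ be≈0) b-rel x))
            where
            b-supp′ : SupportedOn ((C ∩ E₁) ∪ ⁅ e ⁆) b
            b-supp′ z z∉ = b-supp z (z∉ ∘ D⊆)
            g∈C  = p∩q⊆p C E₁ g∈C∩E₁
            g∈E₁ = p∩q⊆q C E₁ g∈C∩E₁
            C-independent : ¬ (b e ≈ 0#) → RowsIndependent A C
            C-independent be≉0 c supp rel z =
              cancel scale (c z) scale≉0 (trans (scale*c≈part₁ z)
                (C∩E₁-independent part₁ (supportedOn-∪⁅⁆ _ e supported₁ part₁e≈0) relation₁ z))
              where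
              open Splitting (split C⊆ supp rel)
              part₂-off : ∀ {y} → y ≢ e → y ∉ C ∩ E₂ → part₂ y ≈ 0#
              part₂-off y≢e y∉ = supported₂ _ λ y∈ →
                [ y∉ , y≢e ∘ x∈⁅y⁆⇒x≡y e ]′ (x∈p∪q⁻ (C ∩ E₂) ⁅ e ⁆ y∈)
              b-off : ∀ {y} → y ≢ e → y ∉ C ∩ E₁ → b y ≈ 0#
              b-off y≢e y∉ = b-supp′ _ λ y∈ →
                [ y∉ , y≢e ∘ x∈⁅y⁆⇒x≡y e ]′ (x∈p∪q⁻ (C ∩ E₁) ⁅ e ⁆ y∈)
              -- Eliminates `e` between `part₂` and `b`. It also vanishes at `g`: `b` because `g` is
              -- not in `D`, and `part₂` because `g` lies in `E₁` and differs from `e`.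
              w : Fin m → Carrier
              w y = b e * part₂ y + (- part₂ e) * b y
              w-off : ∀ {y} → part₂ y ≈ 0# → b y ≈ 0# → w y ≈ 0#
              w-off p≈0 b≈0 = x≈0∧y≈0⇒x+y≈0 (y≈0⇒x*y≈0 _ p≈0) (y≈0⇒x*y≈0 _ b≈0)
              w-supp : SupportedOn (C ∖ g) w
              w-supp y y∉ with e Fin.≟ y | g Fin.≟ y
              ... | yes ≡.refl | _          = x*y+-y*x≈0 (b e) (part₂ e)
              ... | no  e≢y    | yes ≡.refl = w-off
                (part₂-off (e≢y ∘ ≡.sym) λ y∈ → e≢y (≡.sym (meet g∈E₁ (p∩q⊆q C E₂ y∈)))) (b-supp g g∉D)
              ... | no  e≢y    | no  g≢y    = w-off
                (part₂-off (e≢y ∘ ≡.sym) (y∉C ∘ p∩q⊆p C E₂)) (b-off (e≢y ∘ ≡.sym) (y∉C ∘ p∩q⊆p C E₁))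
                where
                y∉C : y ∉ C
                y∉C y∈C = y∉ (x∈p∧x≢y⇒x∈p-y y∈C (g≢y ∘ ≡.sym))
              w≈0 : ∀ y → w y ≈ 0#
              w≈0 = min (C ∖ g) (x∈p⇒p-x⊂p g∈C) w w-supp
                (relation-combination (b e) (- part₂ e) relation₂ b-rel)
              -- Within `E₁`, `part₂` can be nonzero only at `e`; outside `E₁`, away from `e`, `b`
              -- vanishes and `w` is just `b e * part₂`.
              part₂-supp : SupportedOn ⁅ e ⁆ part₂
              part₂-supp y y∉e with y ∈? E₁
              ... | yes y∈E₁ = part₂-off y≢e λ y∈ → y≢e (meet y∈E₁ (p∩q⊆q C E₂ y∈))
                where y≢e = x∉⁅y⁆⇒x≢y y∉e
              ... | no  y∉E₁ = cancel (b e) (part₂ y) be≉0 (trans (sym (y≈0⇒x+y≈x _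
                (y≈0⇒x*y≈0 _ (b-off (x∉⁅y⁆⇒x≢y y∉e) (y∉E₁ ∘ p∩q⊆q C E₁))))) (w≈0 y))
              scale*c≈part₁ : ∀ y → scale * c y ≈ part₁ y
              scale*c≈part₁ y = trans (sum≈ y) (y≈0⇒x+y≈x _ (ind-e part₂ part₂-supp relation₂ y))
              part₁e≈0 : part₁ e ≈ 0#
              part₁e≈0 = trans (sym (scale*c≈part₁ e)) (y≈0⇒x*y≈0 scale (supp e e∉C))

    -- Circuits of the row matroids on the union of two ground sets.

    rowMatroid-circuit⁺ : ∀ {A : Fin m → J → Carrier} {E C} → C ⊆ E → ¬ RowsIndependent A C → Minimal A C →
                          Circuit (rowMatroid E A) C
    rowMatroid-circuit⁺ C⊆E dep min = C⊆E , dep ∘ proj₂ , λ D D⊂C → C⊆E ∘ proj₁ D⊂C , min D D⊂C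

    rowMatroid-circuit⁻ : ∀ {A : Fin m → J → Carrier} {E C} → Circuit (rowMatroid E A) C →
                          C ⊆ E × ¬ RowsIndependent A C × Minimal A C
    rowMatroid-circuit⁻ (C⊆E , dep , min) = C⊆E , (λ ind → dep (C⊆E , ind)) , λ D D⊂C → proj₂ (min D D⊂C)

    module _ {A : Fin m → J → Carrier} {e : Fin m} {E₁ E₂ : Subset m}
             (meet : E₁ ∩ E₂ ≡ ⁅ e ⁆) (ind-e : RowsIndependent A ⁅ e ⁆)
             (split : SplitsAlong A e E₁ E₂) where

      private
        M₁ = rowMatroid E₁ A
        M₂ = rowMatroid E₂ A

        meet⇒≡e : ∀ {x} → x ∈ E₁ → x ∈ E₂ → x ≡ e
        meet⇒≡e x∈E₁ x∈E₂ = x∈⁅y⁆⇒x≡y e (≡.subst (_ ∈_) meet (x∈p∩q⁺ (x∈E₁ , x∈E₂)))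

        e∈E₁∩E₂ : e ∈ E₁ ∩ E₂
        e∈E₁∩E₂ = ≡.subst (e ∈_) (≡.sym meet) (x∈⁅x⁆ e)

        e∈E₁ = p∩q⊆p E₁ E₂ e∈E₁∩E₂
        e∈E₂ = p∩q⊆q E₁ E₂ e∈E₁∩E₂

      gluedCircuit⇒circuit : ∀ {C} → GluedCircuit M₁ M₂ e C → Circuit (rowMatroid (E₁ ∪ E₂) A) C
      gluedCircuit⇒circuit (C₁ , C₂ , (circ₁ , e∈C₁) , (circ₂ , e∈C₂) , ≡.refl)
        with rowMatroid-circuit⁻ {E = E₁} circ₁ | rowMatroid-circuit⁻ {E = E₂} circ₂
      ... | C₁⊆E₁ , dep₁ , min₁ | C₂⊆E₂ , dep₂ , min₂ = rowMatroid-circuit⁺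
        (x∈p∪q⁺ ∘ Sum.map C₁⊆E₁ C₂⊆E₂ ∘ x∈p∪q⁻ C₁ C₂ ∘ p─q⊆p (C₁ ∪ C₂) ⁅ e ⁆)
        (glued-dependent meet⇒≡e split C₁⊆E₁ C₂⊆E₂ ind-e e∈C₁ e∈C₂ dep₁ dep₂ min₂)
        minimal
        where
        minimal : Minimal A ((C₁ ∪ C₂) ∖ e)
        minimal D (D⊆ , f , f∈ , f∉D) =
          [ (λ f∈C₁ → glued-independent meet⇒≡e split C₁⊆E₁ C₂⊆E₂ e∈C₁ e∈C₂ min₁ min₂
                        D⊆C₁∪C₂ e∉D f∈C₁ f≢e f∉D)
          , (λ f∈C₂ → glued-independent (λ x∈E₂ x∈E₁ → meet⇒≡e x∈E₁ x∈E₂) (splitsAlong-swap split)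
                        C₂⊆E₂ C₁⊆E₁ e∈C₂ e∈C₁ min₂ min₁
                        (x∈p∪q⁺ ∘ Sum.swap ∘ x∈p∪q⁻ C₁ C₂ ∘ D⊆C₁∪C₂) e∉D f∈C₂ f≢e f∉D)
          ]′ (x∈p∪q⁻ C₁ C₂ (p─q⊆p (C₁ ∪ C₂) ⁅ e ⁆ f∈))
          where
          D⊆C₁∪C₂ : D ⊆ C₁ ∪ C₂
          D⊆C₁∪C₂ = p─q⊆p (C₁ ∪ C₂) ⁅ e ⁆ ∘ D⊆
          f≢e : f ≢ e
          f≢e = x∈p∖y⇒x≢y {p = C₁ ∪ C₂} f∈
          e∉D : e ∉ D
          e∉D e∈D = x∈p∖y⇒x≢y {p = C₁ ∪ C₂} (D⊆ e∈D) ≡.refl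

      circuit⇒gluedCircuit : ∀ {C f₁ f₂} → Circuit (rowMatroid (E₁ ∪ E₂) A) C →
        f₁ ∈ C → f₁ ∉ E₁ → f₂ ∈ C → f₂ ∉ E₂ → GluedCircuit M₁ M₂ e C
      circuit⇒gluedCircuit {C} circ f₁∈C f₁∉E₁ f₂∈C f₂∉E₂ with rowMatroid-circuit⁻ {E = E₁ ∪ E₂} circ
      ... | C⊆ , dep , min =
        C₁ , C₂ ,
        (rowMatroid-circuit⁺ (half⊆ e∈E₁)
          (half-dependent meet⇒≡e split C⊆ dep min f₁∈C f₁∉E₁ f₂∈C f₂∉E₂ e∉C)
          (half-minimal meet⇒≡e split C⊆ dep min f₁∈C f₁∉E₁ f₂∈C f₂∉E₂ e∉C ind-e)
        , x∈p∪q⁺ (inj₂ (x∈⁅x⁆ e))) ,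
        (rowMatroid-circuit⁺ (half⊆ e∈E₂)
          (half-dependent meet′ split′ C⊆′ dep min f₂∈C f₂∉E₂ f₁∈C f₁∉E₁ e∉C)
          (half-minimal meet′ split′ C⊆′ dep min f₂∈C f₂∉E₂ f₁∈C f₁∉E₁ e∉C ind-e)
        , x∈p∪q⁺ (inj₂ (x∈⁅x⁆ e))) ,
        ⊆-antisym C⊆glued glued⊆C
        where
        C₁ = (C ∩ E₁) ∪ ⁅ e ⁆
        C₂ = (C ∩ E₂) ∪ ⁅ e ⁆
        meet′ : ∀ {x} → x ∈ E₂ → x ∈ E₁ → x ≡ e
        meet′ x∈E₂ x∈E₁ = meet⇒≡e x∈E₁ x∈E₂
        split′ = splitsAlong-swap split
        C⊆′ : C ⊆ E₂ ∪ E₁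
        C⊆′ = x∈p∪q⁺ ∘ Sum.swap ∘ x∈p∪q⁻ E₁ E₂ ∘ C⊆
        e∉C : e ∉ C
        e∉C = gluing-∉-circuit meet⇒≡e split C⊆ dep min f₁∈C f₁∉E₁ f₂∈C f₂∉E₂ e∈E₁ e∈E₂
        half⊆ : ∀ {E} → e ∈ E → (C ∩ E) ∪ ⁅ e ⁆ ⊆ E
        half⊆ {E} e∈E x∈ = [ p∩q⊆q C E , (λ x∈e → ≡.subst (_∈ E) (≡.sym (x∈⁅y⁆⇒x≡y e x∈e)) e∈E) ]′
                             (x∈p∪q⁻ (C ∩ E) ⁅ e ⁆ x∈)
        C⊆glued : C ⊆ (C₁ ∪ C₂) ∖ e
        C⊆glued {x} x∈C = x∈p∧x≢y⇒x∈p-y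
          (x∈p∪q⁺ (Sum.map (λ x∈E₁ → x∈p∪q⁺ (inj₁ (x∈p∩q⁺ (x∈C , x∈E₁))))
                           (λ x∈E₂ → x∈p∪q⁺ (inj₁ (x∈p∩q⁺ (x∈C , x∈E₂)))) (x∈p∪q⁻ E₁ E₂ (C⊆ x∈C))))
          λ where ≡.refl → e∉C x∈C
        glued⊆C : (C₁ ∪ C₂) ∖ e ⊆ C
        glued⊆C {x} x∈ = [ from-half E₁ , from-half E₂ ]′ (x∈p∪q⁻ C₁ C₂ (p─q⊆p (C₁ ∪ C₂) ⁅ e ⁆ x∈))
          where
          from-half : ∀ E → x ∈ (C ∩ E) ∪ ⁅ e ⁆ → x ∈ C
          from-half E x∈half = [ p∩q⊆p C E , (λ x∈e →
            contradiction (x∈⁅y⁆⇒x≡y e x∈e) (x∈p∖y⇒x≢y {p = C₁ ∪ C₂} x∈)) ]′ (x∈p∪q⁻ (C ∩ E) ⁅ e ⁆ x∈half)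

      -- Being a circuit depends on the ground set only through inclusion, so circuits inside `E₁`
      -- or `E₂` carry over unchanged. What remains are the circuits that leave both, and these are
      -- the glued ones.
      rowMatroid-∪-circuit : ∀ C → Circuit (rowMatroid (E₁ ∪ E₂) A) C ⇔
                             (Circuit M₁ C ⊎ Circuit M₂ C ⊎ GluedCircuit M₁ M₂ e C)
      rowMatroid-∪-circuit C = mk⇔ to [ enlarge (p⊆p∪q E₂) , [ enlarge (q⊆p∪q E₁ E₂) , gluedCircuit⇒circuit ]′ ]′
        where
        enlarge : ∀ {E} → E ⊆ E₁ ∪ E₂ → Circuit (rowMatroid E A) C → Circuit (rowMatroid (E₁ ∪ E₂) A) C
        enlarge {E} E⊆ circ with rowMatroid-circuit⁻ {E = E} circ
        ... | C⊆E , dep , min = rowMatroid-circuit⁺ (E⊆ ∘ C⊆E) dep min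
        restrict : ∀ {E} → C ⊆ E → Circuit (rowMatroid (E₁ ∪ E₂) A) C → Circuit (rowMatroid E A) C
        restrict C⊆E circ with rowMatroid-circuit⁻ {E = E₁ ∪ E₂} circ
        ... | _ , dep , min = rowMatroid-circuit⁺ C⊆E dep min
        to : Circuit (rowMatroid (E₁ ∪ E₂) A) C → Circuit M₁ C ⊎ Circuit M₂ C ⊎ GluedCircuit M₁ M₂ e C
        to circ with nonempty? (C ─ E₁) | nonempty? (C ─ E₂)
        ... | no  empty      | _              = inj₁ (restrict (─-empty⇒⊆ empty) circ)
        ... | yes _          | no  empty      = inj₂ (inj₁ (restrict (─-empty⇒⊆ empty) circ))
        ... | yes (f₁ , f₁∈) | yes (f₂ , f₂∈) = inj₂ (inj₂ (circuit⇒gluedCircuit circ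
          (p─q⊆p C E₁ f₁∈) (x∈p─q⇒x∉q {p = C} f₁∈) (p─q⊆p C E₂ f₂∈) (x∈p─q⇒x∉q {p = C} f₂∈)))

      -- Deleting `e` from the ground set keeps exactly the circuits that avoid `e`; glued circuits
      -- avoid it by their form.
      rowMatroid-∪∖-circuit : ∀ C → Circuit (rowMatroid ((E₁ ∪ E₂) ∖ e) A) C ⇔
        ((Circuit M₁ C × e ∉ C) ⊎ (Circuit M₂ C × e ∉ C) ⊎ GluedCircuit M₁ M₂ e C)
      rowMatroid-∪∖-circuit C = mk⇔ to from
        where
        open Equivalence (rowMatroid-∪-circuit C) renaming (to to to-∪; from to from-∪)
        to : Circuit (rowMatroid ((E₁ ∪ E₂) ∖ e) A) C →
             (Circuit M₁ C × e ∉ C) ⊎ (Circuit M₂ C × e ∉ C) ⊎ GluedCircuit M₁ M₂ e C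
        to circ with rowMatroid-circuit⁻ {E = (E₁ ∪ E₂) ∖ e} circ
        ... | C⊆ , dep , min = Sum.map (_, e∉C) (Sum.map₁ (_, e∉C))
          (to-∪ (rowMatroid-circuit⁺ (p─q⊆p (E₁ ∪ E₂) ⁅ e ⁆ ∘ C⊆) dep min))
          where
          e∉C : e ∉ C
          e∉C e∈C = x∈p∖y⇒x≢y {p = E₁ ∪ E₂} (C⊆ e∈C) ≡.refl
        delete : e ∉ C → Circuit (rowMatroid (E₁ ∪ E₂) A) C → Circuit (rowMatroid ((E₁ ∪ E₂) ∖ e) A) C
        delete e∉C circ with rowMatroid-circuit⁻ {E = E₁ ∪ E₂} circ
        ... | C⊆ , dep , min = rowMatroid-circuit⁺
          (λ x∈C → x∈p∧x≢y⇒x∈p-y (C⊆ x∈C) λ where ≡.refl → e∉C x∈C) dep min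
        from : (Circuit M₁ C × e ∉ C) ⊎ (Circuit M₂ C × e ∉ C) ⊎ GluedCircuit M₁ M₂ e C →
               Circuit (rowMatroid ((E₁ ∪ E₂) ∖ e) A) C
        from (inj₁ (circ , e∉C))        = delete e∉C (from-∪ (inj₁ circ))
        from (inj₂ (inj₁ (circ , e∉C))) = delete e∉C (from-∪ (inj₂ (inj₁ circ)))
        from (inj₂ (inj₂ glued@(C₁ , C₂ , _ , _ , ≡.refl))) = delete
          (λ e∈ → x∈p∖y⇒x≢y {p = C₁ ∪ C₂} e∈ ≡.refl) (from-∪ (inj₂ (inj₂ glued)))

  -- Forces and torques in a framework.

  sum-pair : ∀ {n} {a b : Fin n} → (h : Fin n → Carrier) → (∀ {w} → w ≢ a → w ≢ b → h w ≈ 0#) → a ≢ b →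
             ∑[ w < n ] h w ≈ h a + h b
  sum-pair {n} {a} {b} h h≈0 a≢b = begin
    ∑[ w < n ] h w
      ≈⟨ sum-cong-≋ term ⟨
    ∑[ w < n ] ((1# * δ a w + 1# * δ b w) * h w)
      ≈⟨ sum-combination 1# 1# (δ a) (δ b) h ⟩
    1# * (∑[ w < n ] (δ a w * h w)) + 1# * (∑[ w < n ] (δ b w * h w))
      ≈⟨ +-cong (trans (*-identityˡ _) (sum-δ a h)) (trans (*-identityˡ _) (sum-δ b h)) ⟩
    h a + h b ∎
    where
    term : ∀ w → (1# * δ a w + 1# * δ b w) * h w ≈ h w
    term w with a Fin.≟ w | b Fin.≟ w
    ... | yes ≡.refl | yes ≡.refl = contradiction ≡.refl a≢b
    ... | yes _      | no  _      = trans (*-congʳ (trans (y≈0⇒x+y≈x _ (zeroʳ 1#)) (*-identityˡ 1#))) (*-identityˡ _)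
    ... | no  _      | yes _      = trans (*-congʳ (trans (x≈0⇒x+y≈y _ (zeroʳ 1#)) (*-identityˡ 1#))) (*-identityˡ _)
    ... | no  a≢w    | no  b≢w    = trans (y≈0⇒x*y≈0 _ hw≈0) (sym hw≈0)
      where hw≈0 = h≈0 (a≢w ∘ ≡.sym) (b≢w ∘ ≡.sym)

  module Rigidity {n d : ℕ} (p : Fin n → Fin d → Carrier) where

    edgeVector : Fin (n ℕ.* n) → Fin d → Carrier
    edgeVector e k = p (source n e) k + - p (target n e) k

    -- Columns are indexed by all labels rather than by the vertices of one graph, so that both
    -- graphs and their union take rows from a single matrix.
    entry : Fin (n ℕ.* n) → Fin n × Fin d → Carrier
    entry e (w , k) =
      if does (w Fin.≟ source n e) then p (source n e) k + - p (target n e) k else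
      if does (w Fin.≟ target n e) then p (target n e) k + - p (source n e) k else
      0#

    entry-source : ∀ e k → entry e (source n e , k) ≈ edgeVector e k
    entry-source e k with source n e Fin.≟ source n e
    ... | yes _   = refl
    ... | no  u≢u = contradiction ≡.refl u≢u

    entry-target : ∀ {e} k → source n e ≢ target n e → entry e (target n e , k) ≈ - edgeVector e k
    entry-target {e} k u≢v with target n e Fin.≟ source n e | target n e Fin.≟ target n e
    ... | yes v≡u | _       = contradiction (≡.sym v≡u) u≢v
    ... | no  _   | yes _   = sym (⁻¹-anti-homo‿- _ _)
    ... | no  _   | no  v≢v = contradiction ≡.refl v≢v

    entry-other : ∀ {e w} k → w ≢ source n e → w ≢ target n e → entry e (w , k) ≈ 0#
    entry-other {e} {w} k w≢u w≢v with w Fin.≟ source n e | w Fin.≟ target n e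
    ... | yes w≡u | _       = contradiction w≡u w≢u
    ... | no  _   | yes w≡v = contradiction w≡v w≢v
    ... | no  _   | no  _   = refl

    edge-independent : ∀ {e} k → ¬ (edgeVector e k ≈ 0#) → RowsIndependent entry ⁅ e ⁆
    edge-independent {e} k x≉0 = singleton-independent (source n e , k) λ entry≈0 →
      x≉0 (trans (sym (entry-source e k)) entry≈0)

    sum-entry : ∀ {e} k (g : Fin n → Carrier) → source n e ≢ target n e →
      ∑[ w < n ] (entry e (w , k) * g w) ≈ edgeVector e k * (g (source n e) + - g (target n e))
    sum-entry {e} k g u≢v = begin
      ∑[ w < n ] (entry e (w , k) * g w)
        ≈⟨ sum-pair (λ w → entry e (w , k) * g w) (λ w≢u w≢v → x≈0⇒x*y≈0 _ (entry-other k w≢u w≢v)) u≢v ⟩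
      entry e (source n e , k) * g (source n e) + entry e (target n e , k) * g (target n e)
        ≈⟨ +-cong (*-congʳ (entry-source e k)) (*-congʳ (entry-target k u≢v)) ⟩
      edgeVector e k * g (source n e) + (- edgeVector e k) * g (target n e)
        ≈⟨ +-congˡ (trans (sym (-‿distribˡ-* _ _)) (-‿distribʳ-* _ _)) ⟩
      edgeVector e k * g (source n e) + edgeVector e k * (- g (target n e))
        ≈⟨ distribˡ _ _ _ ⟨
      edgeVector e k * (g (source n e) + - g (target n e)) ∎

    -- A combination of rows, read as the load that the stress `c` exerts on vertex `w`.
    force : (Fin (n ℕ.* n) → Carrier) → Fin n → Fin d → Carrier
    force c w k = ∑[ e < n ℕ.* n ] (c e * entry e (w , k))

    module _ (G : Graph n) {c} (supp : SupportedOn (E G) c) where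

      source≢target : ∀ {e} → e ∈ E G → source n e ≢ target n e
      source≢target e∈ u≡v = Fin.<-irrefl u≡v (source<target G e∈)

      force-outside : ∀ {w} k → w ∉ V G → force c w k ≈ 0#
      force-outside {w} k w∉V = sum-zero term
        where
        term : ∀ e → c e * entry e (w , k) ≈ 0#
        term e with e ∈? E G
        ... | no  e∉ = x≈0⇒x*y≈0 _ (supp e e∉)
        ... | yes e∈ = y≈0⇒x*y≈0 _ (entry-other k (λ w≡u → w∉V (≡.subst (_∈ V G) (≡.sym w≡u) (source∈V G e∈)))
                                                   (λ w≡v → w∉V (≡.subst (_∈ V G) (≡.sym w≡v) (target∈V G e∈))))

      -- The work of the load along a test function `g`. After the two sums are exchanged, an edge
      -- contributes only at its ends, with opposite vectors. Constant `g` gives balance of forces,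
      -- a coordinate of `p` gives balance of torques.
      sum-force : ∀ k (g : Fin n → Carrier) → ∑[ w < n ] (force c w k * g w) ≈
        ∑[ e < n ℕ.* n ] (c e * (edgeVector e k * (g (source n e) + - g (target n e))))
      sum-force k g = begin
        ∑[ w < n ] (force c w k * g w)
          ≈⟨ sum-cong-≋ (λ w → *-distribʳ-sum (g w) (λ e → c e * entry e (w , k))) ⟩
        ∑[ w < n ] ∑[ e < n ℕ.* n ] ((c e * entry e (w , k)) * g w)
          ≈⟨ ∑-comm (λ w e → (c e * entry e (w , k)) * g w) ⟩
        ∑[ e < n ℕ.* n ] ∑[ w < n ] ((c e * entry e (w , k)) * g w)
          ≈⟨ sum-cong-≋ row ⟩
        ∑[ e < n ℕ.* n ] (c e * (edgeVector e k * (g (source n e) + - g (target n e)))) ∎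
        where
        row : ∀ e → ∑[ w < n ] ((c e * entry e (w , k)) * g w) ≈
                    c e * (edgeVector e k * (g (source n e) + - g (target n e)))
        row e = begin
          ∑[ w < n ] ((c e * entry e (w , k)) * g w)
            ≈⟨ sum-cong-≋ (λ w → *-assoc (c e) (entry e (w , k)) (g w)) ⟩
          ∑[ w < n ] (c e * (entry e (w , k) * g w))
            ≈⟨ *-distribˡ-sum (c e) (λ w → entry e (w , k) * g w) ⟨
          c e * (∑[ w < n ] (entry e (w , k) * g w))
            ≈⟨ scaled (e ∈? E G) ⟩
          c e * (edgeVector e k * (g (source n e) + - g (target n e))) ∎
          where
          scaled : Dec (e ∈ E G) → c e * (∑[ w < n ] (entry e (w , k) * g w)) ≈
                                   c e * (edgeVector e k * (g (source n e) + - g (target n e)))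
          scaled (yes e∈) = *-congˡ (sum-entry k g (source≢target e∈))
          scaled (no  e∉) = trans (x≈0⇒x*y≈0 _ (supp e e∉)) (sym (x≈0⇒x*y≈0 _ (supp e e∉)))

      force-balance : ∀ k → ∑[ w < n ] (force c w k * 1#) ≈ 0#
      force-balance k = trans (sum-force k (λ _ → 1#))
        (sum-zero λ e → y≈0⇒x*y≈0 (c e) (y≈0⇒x*y≈0 (edgeVector e k) (-‿inverseʳ 1#)))

      -- For `g` the coordinate `l` of `p`, an edge contributes the product of its components `k`
      -- and `l`, which is symmetric. The difference of the two sides is the torque in the plane of
      -- these two axes.
      torque-balance : ∀ k l → ∑[ w < n ] (force c w k * p w l) ≈ ∑[ w < n ] (force c w l * p w k)
      torque-balance k l = begin
        ∑[ w < n ] (force c w k * p w l)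
          ≈⟨ sum-force k (λ w → p w l) ⟩
        ∑[ e < n ℕ.* n ] (c e * (edgeVector e k * edgeVector e l))
          ≈⟨ sum-cong-≋ (λ e → *-congˡ (*-comm (edgeVector e k) (edgeVector e l))) ⟩
        ∑[ e < n ℕ.* n ] (c e * (edgeVector e l * edgeVector e k))
          ≈⟨ sum-force l (λ w → p w k) ⟨
        ∑[ w < n ] (force c w l * p w k) ∎

    -- A force in both row spaces acts only at the two ends of e.  Balance of
    -- forces and torques makes it parallel to e.
    entry-spansMeetInRow : ∀ (G₁ G₂ : Graph n) {e k₀} → e ∈ E G₁ →
      (∀ {w} → w ∈ V G₁ → w ∈ V G₂ → w ≡ source n e ⊎ w ≡ target n e) →
      ¬ (edgeVector e k₀ ≈ 0#) → SpansMeetInRow entry e (E G₁) (E G₂)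
    entry-spansMeetInRow G₁ G₂ {e} {k₀} e∈E₁ meet x≉0 c₁ c₂ supp₁ supp₂ cancels =
      -- The factor of proportionality would be `f a k₀` over `edgeVector e k₀`; cross-multiplied,
      -- its denominator becomes the nonzero scale.
      edgeVector e k₀ , f a k₀ , x≉0 , parallel
      where
      a = source n e
      b = target n e
      a≢b : a ≢ b
      a≢b = source≢target G₁ supp₁ e∈E₁
      f : Fin n → Fin d → Carrier
      f = force c₁
      f-outside : ∀ {w} k → w ≢ a → w ≢ b → f w k ≈ 0#
      f-outside {w} k w≢a w≢b with w ∈? V G₁ | w ∈? V G₂
      ... | no  w∉V₁ | _        = force-outside G₁ supp₁ k w∉V₁
      ... | yes w∈V₁ | yes w∈V₂ = contradiction (meet w∈V₁ w∈V₂) [ w≢a , w≢b ]′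
      -- The load of `c₂` is opposite to that of `c₁` and is zero outside `V G₂`.
      ... | yes _    | no  w∉V₂ = trans (sym (y≈0⇒x+y≈x _ (force-outside G₂ supp₂ k w∉V₂))) (cancels (w , k))
      moment : ∀ k (g : Fin n → Carrier) → ∑[ w < n ] (f w k * g w) ≈ f a k * g a + f b k * g b
      moment k g = sum-pair (λ w → f w k * g w) (λ w≢a w≢b → x≈0⇒x*y≈0 _ (f-outside k w≢a w≢b)) a≢b
      opposite : ∀ k → f b k ≈ - f a k
      opposite k = +-inverseʳ-unique _ _ (begin
        f a k + f b k            ≈⟨ +-cong (*-identityʳ _) (*-identityʳ _) ⟨
        f a k * 1# + f b k * 1#  ≈⟨ moment k (λ _ → 1#) ⟨
        ∑[ w < n ] (f w k * 1#)  ≈⟨ force-balance G₁ supp₁ k ⟩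
        0# ∎)
      couple : ∀ k l → ∑[ w < n ] (f w k * p w l) ≈ f a k * edgeVector e l
      couple k l = begin
        ∑[ w < n ] (f w k * p w l)         ≈⟨ moment k (λ w → p w l) ⟩
        f a k * p a l + f b k * p b l      ≈⟨ +-congˡ (*-congʳ (opposite k)) ⟩
        f a k * p a l + (- f a k) * p b l  ≈⟨ +-congˡ (trans (sym (-‿distribˡ-* _ _)) (-‿distribʳ-* _ _)) ⟩
        f a k * p a l + f a k * (- p b l)  ≈⟨ distribˡ _ _ _ ⟨
        f a k * edgeVector e l ∎
      parallel-a : ∀ k → edgeVector e k₀ * f a k ≈ f a k₀ * edgeVector e k
      parallel-a k = begin
        edgeVector e k₀ * f a k       ≈⟨ *-comm _ _ ⟩
        f a k * edgeVector e k₀       ≈⟨ couple k k₀ ⟨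
        ∑[ w < n ] (f w k * p w k₀)   ≈⟨ torque-balance G₁ supp₁ k k₀ ⟩
        ∑[ w < n ] (f w k₀ * p w k)   ≈⟨ couple k₀ k ⟩
        f a k₀ * edgeVector e k ∎
      parallel : ∀ j → edgeVector e k₀ * f (proj₁ j) (proj₂ j) ≈ f a k₀ * entry e j
      parallel (w , k) with w Fin.≟ a | w Fin.≟ b
      ... | yes ≡.refl | _          = parallel-a k
      ... | no  _      | yes ≡.refl = begin
        edgeVector e k₀ * f b k          ≈⟨ *-congˡ (opposite k) ⟩
        edgeVector e k₀ * (- f a k)      ≈⟨ -‿distribʳ-* _ _ ⟨
        - (edgeVector e k₀ * f a k)      ≈⟨ -‿cong (parallel-a k) ⟩
        - (f a k₀ * edgeVector e k)      ≈⟨ -‿distribʳ-* _ _ ⟩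
        f a k₀ * (- edgeVector e k)      ≈⟨ *-congˡ (⁻¹-anti-homo‿- _ _) ⟩
        f a k₀ * (p b k + - p a k) ∎
      ... | no  w≢a    | no  w≢b    = trans (y≈0⇒x*y≈0 _ (f-outside k w≢a w≢b)) (sym (zeroʳ _))

  entry-transfer : ∀ {n d} (G : Graph n) {p p′ : Fin n → Fin d → Carrier} →
    (_∼_ : Carrier → Carrier → Set) →
    (∀ {x x′} → x ∼ x′ → x′ ≈ 0# → x ≈ 0#) →
    0# ∼ 0# →
    (∀ {x x′ y y′} → x ∼ x′ → y ∼ y′ → (x + y) ∼ (x′ + y′)) →
    (∀ {x x′ y y′} → x ∼ x′ → y ∼ y′ → (x * y) ∼ (x′ * y′)) →
    (∀ {x x′} → x ∼ x′ → (- x) ∼ (- x′)) →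
    (∀ {v} → v ∈ V G → ∀ k → p v k ∼ p′ v k) →
    ∀ {S} → S ⊆ E G → RowsIndependent (Rigidity.entry p) S → RowsIndependent (Rigidity.entry p′) S
  entry-transfer {n} {d} G {p} {p′} _∼_ ∼-zero ∼-0 ∼-+ ∼-* ∼-neg p∼p′ S⊆E =
    independent-transfer _∼_ ∼-zero ∼-+ ∼-* ∼-neg λ e e∈S → entry∼ e (S⊆E e∈S)
    where
    entry∼ : ∀ e → e ∈ E G → ∀ j → Rigidity.entry p e j ∼ Rigidity.entry p′ e j
    entry∼ e e∈E (w , k) with w Fin.≟ source n e | w Fin.≟ target n e
    ... | yes _ | _     = ∼-+ (p∼p′ (source∈V G e∈E) k) (∼-neg (p∼p′ (target∈V G e∈E) k))
    ... | no  _ | yes _ = ∼-+ (p∼p′ (target∈V G e∈E) k) (∼-neg (p∼p′ (source∈V G e∈E) k))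
    ... | no  _ | no  _ = ∼-0

-- Independence is a predicate with values in `Set`, so matroids are compared by logical
-- equivalence, which suffices to transport circuits.
record _≋_ {m} (M M′ : Matroid m) : Set where
  field
    ground-≡ : ground M ≡ ground M′
    indep-⇔  : ∀ S → Indep M S ⇔ Indep M′ S

≋-sym : ∀ {m} {M M′ : Matroid m} → M ≋ M′ → M′ ≋ M
≋-sym M≋M′ = record
  { ground-≡ = ≡.sym ground-≡
  ; indep-⇔  = λ S → mk⇔ (Equivalence.from (indep-⇔ S)) (Equivalence.to (indep-⇔ S))
  }
  where open _≋_ M≋M′

circuit-resp-≋ : ∀ {m} {M M′ : Matroid m} → M ≋ M′ → ∀ {C} → Circuit M C → Circuit M′ C
circuit-resp-≋ M≋M′ {C} (C⊆ , dep , min) =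
  ≡.subst (C ⊆_) ground-≡ C⊆ , dep ∘ Equivalence.from (indep-⇔ C) , λ D → Equivalence.to (indep-⇔ D) ∘ min D
  where open _≋_ M≋M′

gluedCircuit-resp-≋ : ∀ {m} {M₁ M₁′ M₂ M₂′ : Matroid m} {e C} → M₁ ≋ M₁′ → M₂ ≋ M₂′ →
                      GluedCircuit M₁ M₂ e C → GluedCircuit M₁′ M₂′ e C
gluedCircuit-resp-≋ M₁≋ M₂≋ (C₁ , C₂ , (circ₁ , e∈C₁) , (circ₂ , e∈C₂) , C≡) =
  C₁ , C₂ , (circuit-resp-≋ M₁≋ circ₁ , e∈C₁) , (circuit-resp-≋ M₂≋ circ₂ , e∈C₂) , C≡

-- Rational polynomials and their values.

record PolynomialEvaluation (R : CommutativeRing 0ℓ 0ℓ) : Set where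
  open CommutativeRing R hiding (zero)
  field
    scalar     : ℚ → Carrier
    scalar-0   : scalar 0ℚ ≈ 0#
    scalar-1   : scalar 1ℚ ≈ 1#
    scalar-+   : ∀ q r → scalar (q ℚ.+ r) ≈ scalar q + scalar r
    scalar-*   : ∀ q r → scalar (q ℚ.* r) ≈ scalar q * scalar r
    scalar-neg : ∀ q → scalar (ℚ.- q) ≈ - scalar q
    value      : ∀ n → Poly n → Vector Carrier n → Carrier
    value-zero : ∀ q x → value 0 q x ≈ scalar q
    value-[]   : ∀ n x → value (suc n) [] x ≈ 0#
    value-∷    : ∀ n f fs x → value (suc n) (f ∷ fs) x ≈ value n f (tail x) + head x * value (suc n) fs x

constant : ∀ n → ℚ → Poly n
constant zero    q = q
constant (suc n) q = constant n q ∷ []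

indeterminate : ∀ {n} → Fin n → Poly n
indeterminate {suc n} zero    = constant n 0ℚ ∷ constant n 1ℚ ∷ []
indeterminate {suc n} (suc i) = indeterminate i ∷ []

add : ∀ n → Poly n → Poly n → Poly n
add zero    q        r        = q ℚ.+ r
add (suc n) []       gs       = gs
add (suc n) (f ∷ fs) []       = f ∷ fs
add (suc n) (f ∷ fs) (g ∷ gs) = add n f g ∷ add (suc n) fs gs

mul : ∀ n → Poly n → Poly n → Poly n
mul zero    q        r  = q ℚ.* r
mul (suc n) []       gs = []
mul (suc n) (f ∷ fs) gs = add (suc n) (List.map (mul n f) gs) (constant n 0ℚ ∷ mul (suc n) fs gs)

neg : ∀ n → Poly n → Poly n
neg n = mul n (constant n (ℚ.- 1ℚ))

module Polynomials (R : CommutativeRing 0ℓ 0ℓ) (evaluation : PolynomialEvaluation R) where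

  open CommutativeRing R hiding (zero)
  open PolynomialEvaluation evaluation
  open RingProperties ring using (-1*x≈-x)
  open CommutativeSemigroupProperties +-commutativeSemigroup using (interchange)
  open SetoidReasoning setoid

  value-singleton : ∀ n f x → value (suc n) (f ∷ []) x ≈ value n f (tail x)
  value-singleton n f x = begin
    value (suc n) (f ∷ []) x                             ≈⟨ value-∷ n f [] x ⟩
    value n f (tail x) + head x * value (suc n) [] x     ≈⟨ +-congˡ (trans (*-congˡ (value-[] n x)) (zeroʳ _)) ⟩
    value n f (tail x) + 0#                              ≈⟨ +-identityʳ _ ⟩
    value n f (tail x) ∎

  value-constant : ∀ n q x → value n (constant n q) x ≈ scalar q
  value-constant zero    q x = value-zero q x
  value-constant (suc n) q x = trans (value-singleton n (constant n q) x) (value-constant n q (tail x))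

  value-indeterminate : ∀ {n} (i : Fin n) x → value n (indeterminate i) x ≈ x i
  value-indeterminate {suc n} zero x = begin
    value (suc n) (indeterminate {suc n} zero) x
      ≈⟨ value-∷ n (constant n 0ℚ) (constant n 1ℚ ∷ []) x ⟩
    value n (constant n 0ℚ) (tail x) + head x * value (suc n) (constant (suc n) 1ℚ) x
      ≈⟨ +-cong (trans (value-constant n 0ℚ (tail x)) scalar-0)
                (*-congˡ (trans (value-constant (suc n) 1ℚ x) scalar-1)) ⟩
    0# + head x * 1#
      ≈⟨ trans (+-identityˡ _) (*-identityʳ _) ⟩
    head x ∎
  value-indeterminate {suc n} (suc i) x = trans (value-singleton n (indeterminate i) x) (value-indeterminate i (tail x))

  value-add : ∀ n f g x → value n (add n f g) x ≈ value n f x + value n g x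
  value-add zero    q        r        x =
    trans (value-zero (q ℚ.+ r) x) (trans (scalar-+ q r) (sym (+-cong (value-zero q x) (value-zero r x))))
  value-add (suc n) []       gs       x = sym (trans (+-congʳ (value-[] n x)) (+-identityˡ _))
  value-add (suc n) (f ∷ fs) []       x = sym (trans (+-congˡ (value-[] n x)) (+-identityʳ _))
  value-add (suc n) (f ∷ fs) (g ∷ gs) x = begin
    value (suc n) (add n f g ∷ add (suc n) fs gs) x
      ≈⟨ value-∷ n (add n f g) (add (suc n) fs gs) x ⟩
    value n (add n f g) (tail x) + head x * value (suc n) (add (suc n) fs gs) x
      ≈⟨ +-cong (value-add n f g (tail x)) (trans (*-congˡ (value-add (suc n) fs gs x)) (distribˡ (head x) _ _)) ⟩
    (value n f (tail x) + value n g (tail x)) + (head x * value (suc n) fs x + head x * value (suc n) gs x)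
      ≈⟨ interchange _ _ _ _ ⟩
    (value n f (tail x) + head x * value (suc n) fs x) + (value n g (tail x) + head x * value (suc n) gs x)
      ≈⟨ +-cong (value-∷ n f fs x) (value-∷ n g gs x) ⟨
    value (suc n) (f ∷ fs) x + value (suc n) (g ∷ gs) x ∎

  mutual
    value-mul : ∀ n f g x → value n (mul n f g) x ≈ value n f x * value n g x
    value-mul zero    q        r  x =
      trans (value-zero (q ℚ.* r) x) (trans (scalar-* q r) (sym (*-cong (value-zero q x) (value-zero r x))))
    value-mul (suc n) []       gs x = trans (value-[] n x) (sym (trans (*-congʳ (value-[] n x)) (zeroˡ _)))
    value-mul (suc n) (f ∷ fs) gs x = begin
      value (suc n) (add (suc n) (List.map (mul n f) gs) (constant n 0ℚ ∷ mul (suc n) fs gs)) x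
        ≈⟨ value-add (suc n) (List.map (mul n f) gs) (constant n 0ℚ ∷ mul (suc n) fs gs) x ⟩
      value (suc n) (List.map (mul n f) gs) x + value (suc n) (constant n 0ℚ ∷ mul (suc n) fs gs) x
        ≈⟨ +-cong (value-map-mul n f gs x) (value-∷ n (constant n 0ℚ) (mul (suc n) fs gs) x) ⟩
      value n f (tail x) * value (suc n) gs x +
        (value n (constant n 0ℚ) (tail x) + head x * value (suc n) (mul (suc n) fs gs) x)
        ≈⟨ +-congˡ (+-cong (trans (value-constant n 0ℚ (tail x)) scalar-0) (*-congˡ (value-mul (suc n) fs gs x))) ⟩
      value n f (tail x) * value (suc n) gs x + (0# + head x * (value (suc n) fs x * value (suc n) gs x))
        ≈⟨ +-congˡ (trans (+-identityˡ _) (sym (*-assoc _ _ _))) ⟩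
      value n f (tail x) * value (suc n) gs x + (head x * value (suc n) fs x) * value (suc n) gs x
        ≈⟨ distribʳ _ _ _ ⟨
      (value n f (tail x) + head x * value (suc n) fs x) * value (suc n) gs x
        ≈⟨ *-congʳ (value-∷ n f fs x) ⟨
      value (suc n) (f ∷ fs) x * value (suc n) gs x ∎

    value-map-mul : ∀ n f gs x → value (suc n) (List.map (mul n f) gs) x ≈ value n f (tail x) * value (suc n) gs x
    value-map-mul n f []       x = trans (value-[] n x) (sym (trans (*-congˡ (value-[] n x)) (zeroʳ _)))
    value-map-mul n f (g ∷ gs) x = begin
      value (suc n) (mul n f g ∷ List.map (mul n f) gs) x
        ≈⟨ value-∷ n (mul n f g) (List.map (mul n f) gs) x ⟩
      value n (mul n f g) (tail x) + head x * value (suc n) (List.map (mul n f) gs) x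
        ≈⟨ +-cong (value-mul n f g (tail x)) (*-congˡ (value-map-mul n f gs x)) ⟩
      a * b + head x * (a * c)
        ≈⟨ +-congˡ (trans (sym (*-assoc _ a c)) (trans (*-congʳ (*-comm _ a)) (*-assoc a _ c))) ⟩
      a * b + a * (head x * c)
        ≈⟨ distribˡ a _ _ ⟨
      a * (b + head x * c)
        ≈⟨ *-congˡ (value-∷ n g gs x) ⟨
      a * value (suc n) (g ∷ gs) x ∎
      where
      a = value n f (tail x)
      b = value n g (tail x)
      c = value (suc n) gs x

  value-neg : ∀ n f x → value n (neg n f) x ≈ - value n f x
  value-neg n f x = begin
    value n (mul n (constant n (ℚ.- 1ℚ)) f) x
      ≈⟨ value-mul n (constant n (ℚ.- 1ℚ)) f x ⟩
    value n (constant n (ℚ.- 1ℚ)) x * value n f x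
      ≈⟨ *-congʳ (trans (value-constant n (ℚ.- 1ℚ) x) (trans (scalar-neg 1ℚ) (-‿cong scalar-1))) ⟩
    - 1# * value n f x
      ≈⟨ -1*x≈-x _ ⟩
    - value n f x ∎

  difference : ∀ {n} → Fin n → Fin n → Poly n
  difference {n} i j = add n (indeterminate i) (neg n (indeterminate j))

  value-difference : ∀ {n} (i j : Fin n) x → x i + - x j ≈ 0# → value n (difference i j) x ≈ 0#
  value-difference {n} i j x xi-xj≈0 = begin
    value n (difference i j) x
      ≈⟨ value-add n (indeterminate i) (neg n (indeterminate j)) x ⟩
    value n (indeterminate i) x + value n (neg n (indeterminate j)) x
      ≈⟨ +-cong (value-indeterminate i x) (trans (value-neg n (indeterminate j) x) (-‿cong (value-indeterminate j x))) ⟩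
    x i + - x j
      ≈⟨ xi-xj≈0 ⟩
    0# ∎

  value-isZero : ∀ n {f} → IsZero n f → ∀ x → value n f x ≈ 0#
  value-isZero zero    ≡.refl x = trans (value-zero 0ℚ x) scalar-0
  value-isZero (suc n) []       x = value-[] n x
  value-isZero (suc n) {f ∷ fs} (z ∷ zs) x = begin
    value (suc n) (f ∷ fs) x
      ≈⟨ value-∷ n f fs x ⟩
    value n f (tail x) + head x * value (suc n) fs x
      ≈⟨ +-cong (value-isZero n z (tail x)) (trans (*-congˡ (value-isZero (suc n) zs x)) (zeroʳ _)) ⟩
    0# + 0#
      ≈⟨ +-identityˡ 0# ⟩
    0# ∎

  module Values {k : ℕ} (a a′ : Vector Carrier k) where

    -- The image of the polynomial ring in pairs of elements, under evaluation at `a` and `a′`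
    -- together. It is closed under the ring operations, as parallel elimination of two matrices
    -- requires.
    _∼_ : Carrier → Carrier → Set
    x ∼ x′ = ∃ λ f → value k f a ≈ x × value k f a′ ≈ x′

    ∼-zero : (∀ f → value k f a′ ≈ 0# → IsZero k f) → ∀ {x x′} → x ∼ x′ → x′ ≈ 0# → x ≈ 0#
    ∼-zero independent (f , fa≈ , fa′≈) x′≈0 =
      trans (sym fa≈) (value-isZero k (independent f (trans fa′≈ x′≈0)) a)

    ∼-0 : 0# ∼ 0#
    ∼-0 = constant k 0ℚ , trans (value-constant k 0ℚ a) scalar-0 , trans (value-constant k 0ℚ a′) scalar-0

    ∼-+ : ∀ {x x′ y y′} → x ∼ x′ → y ∼ y′ → (x + y) ∼ (x′ + y′)
    ∼-+ (f , fa≈ , fa′≈) (g , ga≈ , ga′≈) = add k f g ,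
      trans (value-add k f g a) (+-cong fa≈ ga≈) , trans (value-add k f g a′) (+-cong fa′≈ ga′≈)

    ∼-* : ∀ {x x′ y y′} → x ∼ x′ → y ∼ y′ → (x * y) ∼ (x′ * y′)
    ∼-* (f , fa≈ , fa′≈) (g , ga≈ , ga′≈) = mul k f g ,
      trans (value-mul k f g a) (*-cong fa≈ ga≈) , trans (value-mul k f g a′) (*-cong fa′≈ ga′≈)

    ∼-neg : ∀ {x x′} → x ∼ x′ → (- x) ∼ (- x′)
    ∼-neg (f , fa≈ , fa′≈) = neg k f ,
      trans (value-neg k f a) (-‿cong fa≈) , trans (value-neg k f a′) (-‿cong fa′≈)

    ∼-indeterminate : ∀ i → a i ∼ a′ i
    ∼-indeterminate i = indeterminate i , value-indeterminate i a , value-indeterminate i a′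

-- Genericity is tested on injective finite lists of coordinates. Listing all vertices makes all
-- coordinates indeterminates of one polynomial ring.
enumerate : ∀ {n} (V : Subset n) → ∃₂ λ k (ι : Fin k → ∃ λ v → v ∈ V) →
  (∀ {i j} → proj₁ (ι i) ≡ proj₁ (ι j) → i ≡ j) × (∀ {v} → v ∈ V → ∃ λ i → proj₁ (ι i) ≡ v)
enumerate []            = 0 , (λ ()) , (λ { {()} }) , λ ()
enumerate (outside ∷ V) with enumerate V
... | k , ι , inj , surj = k , Product.map suc there ∘ ι , inj ∘ Fin.suc-injective , λ where
  (there v∈V) → Product.map₂ (≡.cong suc) (surj v∈V)
enumerate (inside ∷ V) with enumerate V
... | k , ι , inj , surj = suc k , ι′ , inj′ , λ where
    here        → zero , ≡.refl
    (there v∈V) → Product.map suc (≡.cong suc) (surj v∈V)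
  where
  ι′ : Fin (suc k) → ∃ λ v → v ∈ inside ∷ V
  ι′ zero    = zero , here
  ι′ (suc i) = Product.map suc there (ι i)
  inj′ : ∀ {i j} → proj₁ (ι′ i) ≡ proj₁ (ι′ j) → i ≡ j
  inj′ {zero}  {zero}  _  = ≡.refl
  inj′ {suc i} {suc j} eq = ≡.cong suc (inj (Fin.suc-injective eq))

-- Pigeonhole: among the images of `w`, `u`, `v` in the two vertices of `K₂` two coincide, and those
-- of `u` and `v` do not.
≅K₂⇒ends : ∀ {n} {G : Graph n} → G ≅ K₂ → ∀ {u v w} → u ∈ V G → v ∈ V G → u ≢ v → w ∈ V G → w ≡ u ⊎ w ≡ v
≅K₂⇒ends {G = G} G≅K₂ {u} {v} {w} u∈ v∈ u≢v w∈
  with two-values (label (w , w∈)) (label (u , u∈)) (label (v , v∈))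
  where
  open Inverse (_≅_.vertices G≅K₂) using (to; from; strictlyInverseʳ)
  label : Vertex G → Fin 2
  label = proj₁ ∘ to
  two-values : ∀ (x y z : Fin 2) → x ≡ y ⊎ x ≡ z ⊎ y ≡ z
  two-values zero       zero       _          = inj₁ ≡.refl
  two-values (suc zero) (suc zero) _          = inj₁ ≡.refl
  two-values zero       (suc zero) zero       = inj₂ (inj₁ ≡.refl)
  two-values (suc zero) zero       (suc zero) = inj₂ (inj₁ ≡.refl)
  two-values zero       (suc zero) (suc zero) = inj₂ (inj₂ ≡.refl)
  two-values (suc zero) zero       zero       = inj₂ (inj₂ ≡.refl)
... | same = Sum.map label-injective (Sum.[_,_]′ label-injective (λ eq → contradiction (label-injective eq) u≢v)) same
  where
  open Inverse (_≅_.vertices G≅K₂) using (to; from; strictlyInverseʳ)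
  label-injective : ∀ {x y : Vertex G} → proj₁ (to x) ≡ proj₁ (to y) → proj₁ x ≡ proj₁ y
  label-injective {x} {y} eq = ≡.cong proj₁ (≡.trans (≡.sym (strictlyInverseʳ x))
    (≡.trans (≡.cong from (vertex-≡ eq)) (strictlyInverseʳ y)))
    where
    vertex-≡ : ∀ {a b : Vertex K₂} → proj₁ a ≡ proj₁ b → a ≡ b
    vertex-≡ {a , a∈} {_ , b∈} ≡.refl = ≡.cong (a ,_) ([]=-irrelevant a∈ b∈)

-- Generic rigidity matroids and the two gluing operations.

-- The rigidity matrix enters as a parameter known only up to ≈: over ℝ, deciding
-- that it coincides definitionally with entry would unfold all real arithmetic.
module GenericRigidity
  (R : CommutativeRing 0ℓ 0ℓ) (domain : IsDomain R) (evaluation : PolynomialEvaluation R)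
  (rows : ∀ {n d} (G : Graph n) → (Fin n → Vector (CommutativeRing.Carrier R) d) →
          Fin (n ℕ.* n) → Vertex G × Fin d → CommutativeRing.Carrier R)
  (rows≈entry : ∀ {n d} (G : Graph n) (p : Fin n → Vector (CommutativeRing.Carrier R) d) e j →
    CommutativeRing._≈_ R (rows G p e j)
      (DomainLinearAlgebra.Rigidity.entry R domain p e (proj₁ (proj₁ j) , proj₂ j)))
  where

  open CommutativeRing R using (Carrier; _≈_; 0#; _*_; semiring; trans; sym; *-congˡ)
  open SemiringSum semiring using (sum-syntax; sum-cong-≋)
  open PolynomialEvaluation evaluation using (value)
  open RowMatroid R domain
  open DomainLinearAlgebra R domain
  open Polynomials R evaluation

  open Rigidity using (edgeVector; entry; edge-independent; entry-spansMeetInRow; force-outside)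

  -- `Generic` phrased over the abstract ring; at ℝ it unfolds to the original.
  IsGeneric : ∀ {n d} → Graph n → (Fin n → Vector Carrier d) → Set
  IsGeneric {d = d} G p = ∀ k (ι : Fin k → Vertex G × Fin d) → Injective _≡_ _≡_ ι →
    ∀ f → value k f (λ i → p (proj₁ (proj₁ (ι i))) (proj₂ (ι i))) ≈ 0# → IsZero k f

  rigidityMatroid : ∀ {n d} (G : Graph n) → (Fin n → Vector Carrier d) → Matroid (n ℕ.* n)
  rigidityMatroid G p = rowMatroid (E G) (rows G p)

  -- If p′ is generic, a rational polynomial that vanishes at p′ is zero and so
  -- vanishes at p as well: values related by ∼ below are zero at p if at p′.
  module Specialisation {n d : ℕ} (G : Graph n) (p p′ : Fin n → Vector Carrier d) where

    private
      k = proj₁ (enumerate (V G))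
      vertex : Fin k → Vertex G
      vertex = proj₁ (proj₂ (enumerate (V G)))

    ι : Fin (k ℕ.* d) → Vertex G × Fin d
    ι i = Product.map₁ vertex (Fin.remQuot {k} d i)

    ι-injective : Injective _≡_ _≡_ ι
    ι-injective {i} {j} eq = begin
      i                                                 ≡⟨ Fin.combine-remQuot {k} d i ⟨
      Product.uncurry Fin.combine (Fin.remQuot {k} d i) ≡⟨ ≡.cong₂ Fin.combine
          (proj₁ (proj₂ (proj₂ (enumerate (V G)))) (≡.cong (proj₁ ∘ proj₁) eq)) (≡.cong proj₂ eq) ⟩
      Product.uncurry Fin.combine (Fin.remQuot {k} d j) ≡⟨ Fin.combine-remQuot {k} d j ⟩
      j ∎
      where open ≡.≡-Reasoning

    at : (Fin n → Vector Carrier d) → Fin (k ℕ.* d) → Carrier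
    at q i = q (proj₁ (proj₁ (ι i))) (proj₂ (ι i))

    at-surjective : ∀ {v} → v ∈ V G → ∀ l → ∃ λ i → ∀ q → at q i ≡ q v l
    at-surjective v∈V l with proj₂ (proj₂ (proj₂ (enumerate (V G)))) v∈V
    ... | i , ≡.refl = Fin.combine i l , λ q →
      ≡.cong (λ (j , l) → q (proj₁ (vertex j)) l) (Fin.remQuot-combine {k} {d} i l)

    open Values (at p) (at p′) public

    coordinate-∼ : ∀ {v} → v ∈ V G → ∀ l → p v l ∼ p′ v l
    coordinate-∼ v∈V l with at-surjective v∈V l
    ... | i , at≡ = ≡.subst₂ _∼_ (at≡ p) (at≡ p′) (∼-indeterminate i)

  -- Independence at any point persists at a generic one, because pivots that are nonzero at `p`
  -- stay nonzero at `p′`. For two generic points it runs both ways.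
  entry-independent : ∀ {n d} (G : Graph n) (p p′ : Fin n → Vector Carrier d) {S} → IsGeneric G p′ → S ⊆ E G →
    RowsIndependent (entry p) S → RowsIndependent (entry p′) S
  entry-independent G p p′ gen′ =
    entry-transfer G {p} {p′} _∼_ (∼-zero (gen′ _ ι ι-injective)) ∼-0 ∼-+ ∼-* ∼-neg coordinate-∼
    where open Specialisation G p p′

  module _ {n d : ℕ} (G : Graph n) (p : Fin n → Vector Carrier d) where

    -- The columns of vertices outside G vanish on the rows of E G.
    rows⇔entry : ∀ {S} → S ⊆ E G → RowsIndependent (rows G p) S ⇔ RowsIndependent (entry p) S
    rows⇔entry {S} S⊆E = mk⇔
      (λ ind c supp rel → ind c supp λ j → trans (columns c j) (rel (proj₁ (proj₁ j) , proj₂ j)))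
      (λ ind c supp rel → ind c supp (extend c supp rel))
      where
      columns : ∀ c j → ∑[ z < n ℕ.* n ] (c z * rows G p z j) ≈
        ∑[ z < n ℕ.* n ] (c z * entry p z (proj₁ (proj₁ j) , proj₂ j))
      columns c j = sum-cong-≋ λ z → *-congˡ (rows≈entry G p z j)
      extend : ∀ c → SupportedOn S c → Relation (rows G p) c → Relation (entry p) c
      extend c supp rel (w , k) with w ∈? V G
      ... | yes w∈V = trans (sym (columns c ((w , w∈V) , k))) (rel ((w , w∈V) , k))
      ... | no  w∉V = force-outside p G (λ e e∉E → supp e (e∉E ∘ S⊆E)) k w∉V

    edgeVector≉0 : IsGeneric G p → ∀ {e} → e ∈ E G → ∀ k → ¬ (edgeVector p e k ≈ 0#)
    edgeVector≉0 gen {e} e∈E k x≈0 with gen 2 ι ι-injective (difference zero (suc zero)) vanishes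
      where
      ends : Fin 2 → Vertex G
      ends zero       = source n e , source∈V G e∈E
      ends (suc zero) = target n e , target∈V G e∈E
      ι : Fin 2 → Vertex G × Fin d
      ι i = ends i , k
      ι-injective : Injective _≡_ _≡_ ι
      ι-injective {zero}     {zero}     _  = ≡.refl
      ι-injective {zero}     {suc zero} eq = contradiction (source<target G e∈E) (Fin.<-irrefl (≡.cong (proj₁ ∘ proj₁) eq))
      ι-injective {suc zero} {zero}     eq = contradiction (source<target G e∈E) (Fin.<-irrefl (≡.sym (≡.cong (proj₁ ∘ proj₁) eq)))
      ι-injective {suc zero} {suc zero} _  = ≡.refl
      x : Fin 2 → Carrier
      x i = p (proj₁ (ends i)) k
      vanishes : value 2 (difference zero (suc zero)) x ≈ 0#
      vanishes = value-difference zero (suc zero) x x≈0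
    -- In the difference of the two indeterminates, the coefficient of the first one is 1, which is
    -- not 0.
    ... | _ ∷ (() ∷ _) ∷ _

    entry-edge-independent : IsGeneric G p → Fin d → ∀ {e} → e ∈ E G → RowsIndependent (entry p) ⁅ e ⁆
    entry-edge-independent gen k e∈E = edge-independent p k (edgeVector≉0 gen e∈E k)

    edge-notLoop : IsGeneric G p → Fin d → ∀ {e} → e ∈ E G → ¬ Loop (rigidityMatroid G p) e
    edge-notLoop gen k {e} e∈E (⁅e⁆⊆E , dep , _) =
      dep (⁅e⁆⊆E , Equivalence.from (rows⇔entry ⁅e⁆⊆E) (entry-edge-independent gen k e∈E))

  generic-⊆ : ∀ {n d} (G H : Graph n) (p : Fin n → Vector Carrier d) → V H ⊆ V G → IsGeneric G p → IsGeneric H p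
  generic-⊆ G H p V⊆V gen k ι ι-injective = gen k (enlarge ∘ ι) (ι-injective ∘ enlarge-injective)
    where
    enlarge : ∀ {d} → Vertex H × Fin d → Vertex G × Fin d
    enlarge = Product.map₁ (Product.map₂ V⊆V)
    enlarge-injective : ∀ {d} {x y : Vertex H × Fin d} → enlarge x ≡ enlarge y → x ≡ y
    enlarge-injective {x = (v , v∈) , l} {(w , w∈) , l′} eq
      with ≡.cong (proj₁ ∘ proj₁) eq | ≡.cong proj₂ eq
    ... | ≡.refl | ≡.refl = ≡.cong (λ v∈ → (v , v∈) , l) ([]=-irrelevant v∈ w∈)

  rigidityMatroid≋rowMatroid : ∀ {n d} (G H : Graph n) (p q : Fin n → Vector Carrier d) →
    V H ⊆ V G → IsGeneric G p → IsGeneric H q →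
    rigidityMatroid H q ≋ rowMatroid (E H) (entry p)
  rigidityMatroid≋rowMatroid G H p q V⊆V gen-p gen-q = record
    { ground-≡ = ≡.refl
    ; indep-⇔  = λ S → mk⇔
        (λ (S⊆E , ind) → S⊆E , entry-independent H q p (generic-⊆ G H p V⊆V gen-p) S⊆E
                                 (Equivalence.to (rows⇔entry H q S⊆E) ind))
        (λ (S⊆E , ind) → S⊆E , Equivalence.from (rows⇔entry H q S⊆E) (entry-independent H p q gen-q S⊆E ind))
    }

  module _ {n d : ℕ} (1≤d : 1 ≤ d) (G₁ G₂ : Graph n) {e : Fin (n ℕ.* n)}
           (∩≅K₂ : G₁ ∩ᴳ G₂ ≅ K₂) (E∩E≡⁅e⁆ : E G₁ ∩ E G₂ ≡ ⁅ e ⁆)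
           (p₁ p₂ : Fin n → Vector Carrier d) (gen₁ : IsGeneric G₁ p₁) (gen₂ : IsGeneric G₂ p₂)
           (notColoop₁ : ¬ Coloop (rigidityMatroid G₁ p₁) e) (notColoop₂ : ¬ Coloop (rigidityMatroid G₂ p₂) e) where

    private
      G : Graph n
      G = G₁ ∪ᴳ G₂
      -- As `d` is positive, there is a coordinate in which to find a nonzero entry of row `e`.
      k₀ : Fin d
      k₀ = Fin.fromℕ< 1≤d
      e∈E₁∩E₂ : e ∈ E G₁ ∩ E G₂
      e∈E₁∩E₂ = ≡.subst (e ∈_) (≡.sym E∩E≡⁅e⁆) (x∈⁅x⁆ e)
      e∈E₁ : e ∈ E G₁
      e∈E₁ = p∩q⊆p (E G₁) (E G₂) e∈E₁∩E₂
      e∈E₂ : e ∈ E G₂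
      e∈E₂ = p∩q⊆q (E G₁) (E G₂) e∈E₁∩E₂
      e∈E : e ∈ E G
      e∈E = x∈p∪q⁺ (inj₁ e∈E₁)
      gluable : Gluable (rigidityMatroid G₁ p₁) (rigidityMatroid G₂ p₂) e
      gluable = record
        { meet       = E∩E≡⁅e⁆
        ; notLoop₁   = edge-notLoop G₁ p₁ gen₁ k₀ e∈E₁
        ; notLoop₂   = edge-notLoop G₂ p₂ gen₂ k₀ e∈E₂
        ; notColoop₁ = notColoop₁
        ; notColoop₂ = notColoop₂
        }
      ends : ∀ {w} → w ∈ V G₁ → w ∈ V G₂ → w ≡ source n e ⊎ w ≡ target n e
      ends w∈V₁ w∈V₂ = ≅K₂⇒ends ∩≅K₂ (source∈V (G₁ ∩ᴳ G₂) e∈E₁∩E₂) (target∈V (G₁ ∩ᴳ G₂) e∈E₁∩E₂)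
        (λ u≡v → Fin.<-irrefl u≡v (source<target G₁ e∈E₁)) (x∈p∩q⁺ (w∈V₁ , w∈V₂))

    module _ (p : Fin n → Vector Carrier d) (gen : IsGeneric (G₁ ∪ᴳ G₂) p) where

      private
        M₁≋ : rigidityMatroid G₁ p₁ ≋ rowMatroid (E G₁) (entry p)
        M₁≋ = rigidityMatroid≋rowMatroid G G₁ p p₁ (p⊆p∪q (V G₂)) gen gen₁
        M₂≋ : rigidityMatroid G₂ p₂ ≋ rowMatroid (E G₂) (entry p)
        M₂≋ = rigidityMatroid≋rowMatroid G G₂ p p₂ (q⊆p∪q (V G₁) (V G₂)) gen gen₂
        ind-e : RowsIndependent (entry p) ⁅ e ⁆
        ind-e = entry-edge-independent G p gen k₀ e∈E
        split : SplitsAlong (entry p) e (E G₁) (E G₂)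
        split = spansMeetInRow⇒splitsAlong
          (entry-spansMeetInRow p G₁ G₂ {k₀ = k₀} e∈E₁ ends (edgeVector≉0 G p gen e∈E k₀))

      parallelConnection : IsParallelConnection (rigidityMatroid G₁ p₁) (rigidityMatroid G₂ p₂) e
        (rigidityMatroid (graphicalParallelConnection G₁ G₂) p)
      parallelConnection = record
        { gluable  = gluable
        ; ground-≡ = ≡.refl
        ; circuits = λ C → mk⇔
            (Sum.map (circuit-resp-≋ (≋-sym M₁≋))
                     (Sum.map (circuit-resp-≋ (≋-sym M₂≋)) (gluedCircuit-resp-≋ (≋-sym M₁≋) (≋-sym M₂≋)))
              ∘ Equivalence.to (rowMatroid-∪-circuit E∩E≡⁅e⁆ ind-e split C)
              ∘ circuit-resp-≋ (rigidityMatroid≋rowMatroid G G p p ⊆-refl gen gen))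
            (circuit-resp-≋ (≋-sym (rigidityMatroid≋rowMatroid G G p p ⊆-refl gen gen))
              ∘ Equivalence.from (rowMatroid-∪-circuit E∩E≡⁅e⁆ ind-e split C)
              ∘ Sum.map (circuit-resp-≋ M₁≋)
                        (Sum.map (circuit-resp-≋ M₂≋) (gluedCircuit-resp-≋ M₁≋ M₂≋)))
        }

      -- Deleting an edge leaves the vertex set alone, so `gen` also serves as genericity for the
      -- 2-sum.
      twoSum : Is2Sum (rigidityMatroid G₁ p₁) (rigidityMatroid G₂ p₂) e
        (rigidityMatroid (graphical2Sum G₁ G₂ e) p)
      twoSum = record
        { gluable  = gluable
        ; ground-≡ = ≡.refl
        ; circuits = λ C → mk⇔
            (Sum.map (Product.map₁ (circuit-resp-≋ (≋-sym M₁≋)))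
                     (Sum.map (Product.map₁ (circuit-resp-≋ (≋-sym M₂≋))) (gluedCircuit-resp-≋ (≋-sym M₁≋) (≋-sym M₂≋)))
              ∘ Equivalence.to (rowMatroid-∪∖-circuit E∩E≡⁅e⁆ ind-e split C)
              ∘ circuit-resp-≋ (rigidityMatroid≋rowMatroid G (graphical2Sum G₁ G₂ e) p p ⊆-refl gen gen))
            (circuit-resp-≋ (≋-sym (rigidityMatroid≋rowMatroid G (graphical2Sum G₁ G₂ e) p p ⊆-refl gen gen))
              ∘ Equivalence.from (rowMatroid-∪∖-circuit E∩E≡⁅e⁆ ind-e split C)
              ∘ Sum.map (Product.map₁ (circuit-resp-≋ M₁≋))
                        (Sum.map (Product.map₁ (circuit-resp-≋ M₂≋)) (gluedCircuit-resp-≋ M₁≋ M₂≋)))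
        }

-- Instantiation at the real numbers.

open Defs

pointwise : ∀ {x y} → (∀ n → seq x n ≡ seq y n) → x ≃ y
pointwise {x} {y} x≡y = mk≃ λ ε 0<ε → 0 , λ n _ →
  -- That a constant sequence is Cauchy supplies the bound on the absolute value of a rational minus
  -- itself.
  ≡.subst (λ r → ℚ.∣ seq x n ℚ.- r ∣ ℚ.< ε) (x≡y n) (proj₂ (cauchy (fromℚ (seq x n)) ε 0<ε) 0 0 ℕ.z≤n ℕ.z≤n)

ℝ-evaluation : PolynomialEvaluation ℝ-commutativeRing
ℝ-evaluation = record
  { scalar     = fromℚ
  ; scalar-0   = pointwise λ _ → ≡.refl
  ; scalar-1   = pointwise λ _ → ≡.refl
  ; scalar-+   = λ q r → pointwise λ _ → ≡.refl
  ; scalar-*   = λ q r → pointwise λ _ → ≡.refl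
  ; scalar-neg = λ q → pointwise λ _ → ≡.refl
  ; value      = eval
  ; value-zero = λ _ _ → pointwise λ _ → ≡.refl
  ; value-[]   = λ _ _ → pointwise λ _ → ≡.refl
  ; value-∷    = λ _ _ _ _ → pointwise λ _ → ≡.refl
  }

≃-if₂ : ∀ b c {x x′ y y′ z z′} → x ≃ x′ → y ≃ y′ → z ≃ z′ →
  (if b then x else if c then y else z) ≃ (if b then x′ else if c then y′ else z′)
≃-if₂ true  _     x≃x′ _    _    = x≃x′
≃-if₂ false true  _    y≃y′ _    = y≃y′
≃-if₂ false false _    _    z≃z′ = z≃z′

rigidityMatrix≃entry : ∀ {n d} (G : Graph n) (p : Fin n → Vector ℝ d) e j → rigidityMatrix G p e j ≃
  DomainLinearAlgebra.Rigidity.entry ℝ-commutativeRing ℝ-isDomain p e (proj₁ (proj₁ j) , proj₂ j)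
rigidityMatrix≃entry {n} G p e ((w , _) , k) = ≃-if₂ (does (w Fin.≟ source n e)) (does (w Fin.≟ target n e))
  (pointwise λ _ → ≡.refl) (pointwise λ _ → ≡.refl) (pointwise λ _ → ≡.refl)

open GenericRigidity ℝ-commutativeRing ℝ-isDomain ℝ-evaluation rigidityMatrix rigidityMatrix≃entry

theorem3p3 : ∀ (n d : ℕ) → 1 ≤ d →
    ∀ (G₁ G₂ : Graph n) e → G₁ ∩ᴳ G₂ ≅ K₂ → E G₁ ∩ E G₂ ≡ ⁅ e ⁆ →
    ∀ (p₁ p₂ : Fin n → Vector ℝ d) → Generic G₁ p₁ → Generic G₂ p₂ →
    ¬ Coloop (ℛ G₁ p₁) e → ¬ Coloop (ℛ G₂ p₂) e →
    (∀ (p : Fin n → Vector ℝ d) → Generic (graphicalParallelConnection G₁ G₂) p →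
    IsParallelConnection (ℛ G₁ p₁) (ℛ G₂ p₂) e (ℛ (graphicalParallelConnection G₁ G₂) p)) ×
    (∀ (p : Fin n → Vector ℝ d) → Generic (graphical2Sum G₁ G₂ e) p →
    Is2Sum (ℛ G₁ p₁) (ℛ G₂ p₂) e (ℛ (graphical2Sum G₁ G₂ e) p))
theorem3p3 n d 1≤d G₁ G₂ e ∩≅K₂ E∩E≡⁅e⁆ p₁ p₂ gen₁ gen₂ notColoop₁ notColoop₂ =
  (λ p gen → parallelConnection {n} {d} 1≤d G₁ G₂ {e} ∩≅K₂ E∩E≡⁅e⁆ p₁ p₂ gen₁ gen₂ notColoop₁ notColoop₂ p gen) ,
  (λ p gen → twoSum {n} {d} 1≤d G₁ G₂ {e} ∩≅K₂ E∩E≡⁅e⁆ p₁ p₂ gen₁ gen₂ notColoop₁ notColoop₂ p gen)
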